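{- For positive integers $k\ge \ell\ge 2$, the limit \[c_{k,\ell}=\lim_{n\to\infty}\frac{c_{n,k,\ell}}{n^{k-2}}\] exists.
   Context: Let $H_{n,k}=\{0,1,\dots,n-1\}^k$. For $\ell\le k$, an $\ell$-rook is a point $P\in H_{n,k}$ together with a set $D$ of $\ell$ of the $k$ coordinate indices; it covers (attacks) $P$ itself and every point of $H_{n,k}$ which differs from $P$ in exactly one coordinate, that coordinate belonging to $D$. Distinct rooks must occupy distinct points. $c_{n,k,\ell}$ is the maximum number of $\ell$-rooks that can be placed in $H_{n,k}$ so that no point of $H_{n,k}$ is covered by two different rooks. -}

module Defs where

open import Data.Nat as ℕ using (ℕ; zero; suc; _≤_; _^_; _∸_)
open import Data.Nat.Properties using (m^n≢0)
open import Data.Fin using (Fin)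
open import Data.Fin.Subset using (Subset; _∈_; ∣_∣)
open import Data.Vec using (Vec; lookup)
open import Data.List using (List; length; map)
import Data.List as L
open import Data.List.Relation.Unary.Unique.Propositional using (Unique)
open import Data.Product using (Σ; ∃; _×_; _,_; proj₁)
open import Data.Sum using (_⊎_)
open import Data.Integer using (+_)
open import Data.Rational as ℚ using (ℚ; 0ℚ; _<_; _-_)
open import Relation.Binary.PropositionalEquality using (_≡_; _≢_)
open import Relation.Nullary using (¬_)

Point : ℕ → ℕ → Set
Point n k = Vec (Fin n) k

record Rook (n k ℓ : ℕ) : Set where
  constructor rook
  field
    pos  : Point n k
    dirs : Subset k
    size : ∣ dirs ∣ ≡ ℓ
open Rook public

DiffersExactlyAt : ∀ {n k} → Point n k → Point n k → Fin k → Set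
DiffersExactlyAt P Q i = lookup Q i ≢ lookup P i × (∀ j → j ≢ i → lookup Q j ≡ lookup P j)

Covers : ∀ {n k ℓ} → Rook n k ℓ → Point n k → Set
Covers r Q = Q ≡ pos r ⊎ ∃ λ i → i ∈ dirs r × DiffersExactlyAt (pos r) Q i

ValidPlacement : ∀ {n k ℓ} → List (Rook n k ℓ) → Set
ValidPlacement {n} {k} rs =
  Unique (map pos rs) ×
  (∀ (a b : Fin (length rs)) → a ≢ b → ∀ (Q : Point n k) →
     ¬ (Covers (L.lookup rs a) Q × Covers (L.lookup rs b) Q))

IsMaxRooks : ℕ → ℕ → ℕ → ℕ → Set
IsMaxRooks n k ℓ m =
  (Σ (List (Rook n k ℓ)) λ rs → ValidPlacement rs × length rs ≡ m) ×
  (∀ (rs : List (Rook n k ℓ)) → ValidPlacement rs → length rs ≤ m)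

-- a(n) / n^(k-2) as a rational number, for n ≥ 1 (indexed by n-1).
ratio : (ℕ → ℕ) → ℕ → ℕ → ℚ
ratio a k n = ℚ._/_ (+ a (suc n)) (suc n ^ (k ∸ 2)) {{m^n≢0 (suc n) (k ∸ 2)}}

-- Convergence (to a real limit) of a rational sequence, via the Cauchy criterion.
ConvergesInℝ : (ℕ → ℚ) → Set
ConvergesInℝ f = ∀ (ε : ℚ) → 0ℚ < ε →
  ∃ λ N → ∀ m p → N ≤ m → N ≤ p → ℚ.∣ f m - f p ∣ < ε

{-# OPTIONS --safe #-}
-- Write E for the number of ℓ-subsets of the k coordinates and M for the number of those containing a given pair.
-- The limit is E / M, with an explicit rate of convergence.
--
-- Upper bound: an (i,j)-plane contains at most one rook both of whose directions i, j belong to D; double counting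
-- the pairs (rook, {i,j} ⊆ D) gives M c ≤ E n^(k-2).
--
-- Lower bound: let m ≡ 1 modulo a large factorial and read a coordinate in base m as one fine digit and r coarse ones.
-- Besides a position, a rook carries a block D_e (an ℓ-subset).  In every coarse component c its digits x satisfy
-- ∑ x_d = ξ_c + X_{c,e} and ∑ α_d x_d = η_c modulo m.  If two rooks agree off {i,j}, the values of ∑_c ∑_d α_d² x_d
-- differ by ∑_c α_i α_j (X_{c,e′} - X_{c,e}).  The α and X are chosen so that ∑_c α_i α_j X_{c,e} = W · rank, the rank
-- of D_e among the M blocks through {i,j}; restricting that hash to a window of length W ≈ m / M separates all
-- blocks sharing a pair.  The fine digits satisfy two equations supported on D_e; they make the (i,j)-planes with
-- i ∈ D_e, j ∉ D_e sparse, and the few rooks of other blocks meeting such a plane are thrown away.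
-- Averaging over all right-hand sides yields a placement of (1 - O(1/m)) (E / M) n^(k-2) rooks.
module Submission where

open import Defs
open import Data.Nat using (ℕ; _≤_)
open import Algebra.Properties.Group using (⁻¹-anti-homo-//)
open import Data.Bool.Base using (true; false; if_then_else_)
open import Data.Fin.Base using (Fin; zero; suc; toℕ; fromℕ<; punchOut; finToFun; funToFin; combine; inject≤)
import Data.Fin.Properties as Finₚ
open import Data.Fin.Subset as Subset using (Subset; inside; outside; _∈_; _∉_)
open import Data.Fin.Subset.Properties using (_∈?_)
open import Data.Integer.Base as ℤ using (ℤ)
open import Data.Integer.Divisibility.Signed as ℤ∣ using (_∣_; divides; ∣⇒∣ᵤ; ∣m∣n⇒∣m+n; ∣n⇒∣m*n)
open import Data.Integer.DivMod using (_%ℕ_; _/ℕ_; n%ℕd<d; a≡a%ℕn+[a/ℕn]*n)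
import Data.Integer.Properties as ℤₚ
open import Data.Integer.Tactic.RingSolver using (solve-∀)
open import Data.List.Base as List using (List; []; _∷_; _++_; length; filter; allFin; cartesianProductWith; cartesianProduct)
open import Data.List.Membership.Propositional.Properties using (∈-lookup)
import Data.List.Properties as Listₚ
open import Data.List.Relation.Unary.All as All using (All; []; _∷_)
import Data.List.Relation.Unary.All.Properties as Allₚ
open import Data.List.Relation.Unary.AllPairs as AllPairs using (AllPairs; []; _∷_)
import Data.List.Relation.Unary.AllPairs.Properties as AllPairsₚ
open import Data.List.Relation.Unary.Unique.Propositional using (Unique)
import Data.List.Relation.Unary.Unique.Propositional.Properties as Uniqueₚ
open import Data.Nat.Base as ℕ using (zero; suc; z≤n; s≤s; _!)
import Data.Nat.Divisibility as ℕ∣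
import Data.Nat.DivMod as ℕDM
import Data.Nat.Properties as ℕₚ
import Data.Nat.Tactic.RingSolver as ℕ-Solver
open import Data.Product.Base using (∃; ∃₂; _×_; _,_; proj₁; proj₂)
open import Data.Rational as ℚ using (ℚ; mkℚ; 0ℚ)
import Data.Rational.Properties as ℚₚ
open import Data.Rational.Unnormalised as ℚᵘ using (ℚᵘ; mkℚᵘ)
import Data.Rational.Unnormalised.Properties as ℚᵘₚ
open import Data.Sum.Base using (inj₁; inj₂)
open import Data.Vec.Base as Vec using (Vec; []; _∷_; lookup; removeAt; _[_]≔_)
import Data.Vec.Properties as Vecₚ
open import Function.Base using (_∘_; id)
open import Relation.Binary.Definitions using (Symmetric; tri<; tri≈; tri>)
open import Relation.Binary.PropositionalEquality
open import Relation.Nullary using (¬_; Dec; yes; no; ¬?; does; contradiction; _×-dec_)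

-- Finite sums, products and indicators.

module FiniteSums where
  open import Data.Nat.Base using (_+_; _*_; _∸_; _^_; _<_)

  private variable
    A B C : Set

  ∑ : List A → (A → ℕ) → ℕ
  ∑ []       f = 0
  ∑ (x ∷ xs) f = f x + ∑ xs f

  ∑-cong : ∀ (xs : List A) {f g : A → ℕ} → (∀ x → f x ≡ g x) → ∑ xs f ≡ ∑ xs g
  ∑-cong []       e = refl
  ∑-cong (x ∷ xs) e = cong₂ _+_ (e x) (∑-cong xs e)

  ∑-mono : ∀ (xs : List A) {f g : A → ℕ} → (∀ x → f x ≤ g x) → ∑ xs f ≤ ∑ xs g
  ∑-mono []       e = z≤n
  ∑-mono (x ∷ xs) e = ℕₚ.+-mono-≤ (e x) (∑-mono xs e)

  ∑-++ : ∀ (xs ys : List A) (f : A → ℕ) → ∑ (xs ++ ys) f ≡ ∑ xs f + ∑ ys f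
  ∑-++ []       ys f = refl
  ∑-++ (x ∷ xs) ys f = trans (cong (f x +_) (∑-++ xs ys f)) (sym (ℕₚ.+-assoc (f x) _ _))

  ∑-map : ∀ (g : A → B) (xs : List A) (f : B → ℕ) → ∑ (List.map g xs) f ≡ ∑ xs (f ∘ g)
  ∑-map g []       f = refl
  ∑-map g (x ∷ xs) f = cong (f (g x) +_) (∑-map g xs f)

  ∑-distrib-+ : ∀ (xs : List A) (f g : A → ℕ) → ∑ xs (λ x → f x + g x) ≡ ∑ xs f + ∑ xs g
  ∑-distrib-+ []       f g = refl
  ∑-distrib-+ (x ∷ xs) f g = trans (cong (f x + g x +_) (∑-distrib-+ xs f g))
                                   (interchange (f x) (g x) _ _)
    where
    interchange : ∀ a b c d → a + b + (c + d) ≡ a + c + (b + d)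
    interchange = ℕ-Solver.solve-∀

  ∑-*ˡ : ∀ (xs : List A) c (f : A → ℕ) → ∑ xs (λ x → c * f x) ≡ c * ∑ xs f
  ∑-*ˡ []       c f = sym (ℕₚ.*-zeroʳ c)
  ∑-*ˡ (x ∷ xs) c f = trans (cong (c * f x +_) (∑-*ˡ xs c f)) (sym (ℕₚ.*-distribˡ-+ c (f x) _))

  ∑-*ʳ : ∀ (xs : List A) c (f : A → ℕ) → ∑ xs (λ x → f x * c) ≡ ∑ xs f * c
  ∑-*ʳ xs c f = trans (∑-cong xs (λ x → ℕₚ.*-comm (f x) c))
                      (trans (∑-*ˡ xs c f) (ℕₚ.*-comm c _))

  ∑-const : ∀ (xs : List A) c → ∑ xs (λ _ → c) ≡ length xs * c
  ∑-const []       c = refl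
  ∑-const (x ∷ xs) c = cong (c +_) (∑-const xs c)

  ∑-swap : ∀ (xs : List A) (ys : List B) (f : A → B → ℕ) →
    ∑ xs (λ x → ∑ ys (f x)) ≡ ∑ ys (λ y → ∑ xs (λ x → f x y))
  ∑-swap []       ys f = sym (trans (∑-const ys 0) (ℕₚ.*-zeroʳ (length ys)))
  ∑-swap (x ∷ xs) ys f = trans (cong (∑ ys (f x) +_) (∑-swap xs ys f))
                               (sym (∑-distrib-+ ys (f x) _))

  ∑-allFin-suc : ∀ n (f : Fin (suc n) → ℕ) →
    ∑ (allFin (suc n)) f ≡ f zero + ∑ (allFin n) (f ∘ suc)
  ∑-allFin-suc n f = cong (f zero +_)
    (trans (cong (λ l → ∑ l f) (sym (Listₚ.map-tabulate id suc))) (∑-map suc (allFin n) f))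

  ∑-cartesianProductWith : ∀ (g : A → B → C) xs ys (f : C → ℕ) →
    ∑ (cartesianProductWith g xs ys) f ≡ ∑ xs (λ x → ∑ ys (λ y → f (g x y)))
  ∑-cartesianProductWith g []       ys f = refl
  ∑-cartesianProductWith g (x ∷ xs) ys f =
    trans (∑-++ (List.map (g x) ys) _ f)
          (cong₂ _+_ (∑-map (g x) ys f) (∑-cartesianProductWith g xs ys f))

  -- This turns a sum of 0/1 weights into the size of an actual selection: of rooks in the upper
  -- bound, of cells with blocks in the lower bound.
  ∑≤length-support : ∀ (xs : List A) (f : A → ℕ) → (∀ x → f x ≤ 1) →
    ∑ xs f ≤ length (filter (λ x → ¬? (f x ℕₚ.≟ 0)) xs)
  ∑≤length-support []       f b = z≤n
  ∑≤length-support (x ∷ xs) f b with f x | b x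
  ... | zero  | _       = ∑≤length-support xs f b
  ... | suc _ | s≤s z≤n = s≤s (∑≤length-support xs f b)

  ∏ : ∀ {n} → (Fin n → ℕ) → ℕ
  ∏ {zero}  f = 1
  ∏ {suc n} f = f zero * ∏ (f ∘ suc)

  ∏≢0⇒≢0 : ∀ {n} (f : Fin n → ℕ) → ∏ f ≢ 0 → ∀ i → f i ≢ 0
  ∏≢0⇒≢0 f nz zero    eq = nz (cong (_* ∏ (f ∘ suc)) eq)
  ∏≢0⇒≢0 f nz (suc i) eq = ∏≢0⇒≢0 (f ∘ suc) (λ e → nz (trans (cong (f zero *_) e) (ℕₚ.*-zeroʳ (f zero)))) i eq

  ∏≤1 : ∀ {n} (f : Fin n → ℕ) → (∀ i → f i ≤ 1) → ∏ f ≤ 1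
  ∏≤1 {zero}  f b = s≤s z≤n
  ∏≤1 {suc n} f b = ℕₚ.*-mono-≤ (b zero) (∏≤1 (f ∘ suc) (b ∘ suc))

  ∏≡1 : ∀ {n} (f : Fin n → ℕ) → (∀ i → f i ≡ 1) → ∏ f ≡ 1
  ∏≡1 {zero}  f e = refl
  ∏≡1 {suc n} f e = cong₂ _*_ (e zero) (∏≡1 (f ∘ suc) (e ∘ suc))

  ^≤∏ : ∀ {n} (f : Fin n → ℕ) c → (∀ i → c ≤ f i) → c ^ n ≤ ∏ f
  ^≤∏ {zero}  f c b = s≤s z≤n
  ^≤∏ {suc n} f c b = ℕₚ.*-mono-≤ (b zero) (^≤∏ (f ∘ suc) c (b ∘ suc))

  -- The one exceptional factor may fall below `b`; the extra factor `c ≥ b` pays for it.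
  ^≤*∏ : ∀ {n} (f : Fin n → ℕ) b c j → b ≤ c → f j ≡ 1 → (∀ i → i ≢ j → b ≤ f i) → b ^ n ≤ c * ∏ f
  ^≤*∏ {suc n} f b c zero    b≤c fj≡1 bound = begin
    b * b ^ n                      ≤⟨ ℕₚ.*-mono-≤ b≤c (^≤∏ (f ∘ suc) b (λ i → bound (suc i) (λ ()))) ⟩
    c * ∏ (f ∘ suc)                ≡⟨ cong (c *_) (sym (trans (cong (_* ∏ (f ∘ suc)) fj≡1) (ℕₚ.*-identityˡ _))) ⟩
    c * (f zero * ∏ (f ∘ suc))     ∎
    where open ℕₚ.≤-Reasoning
  ^≤*∏ {suc n} f b c (suc j) b≤c fj≡1 bound = begin
    b * b ^ n                      ≤⟨ ℕₚ.*-mono-≤ (bound zero (λ ()))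
                                        (^≤*∏ (f ∘ suc) b c j b≤c fj≡1 (λ i i≢j → bound (suc i) (i≢j ∘ Finₚ.suc-injective))) ⟩
    f zero * (c * ∏ (f ∘ suc))     ≡⟨ swap (f zero) c _ ⟩
    c * (f zero * ∏ (f ∘ suc))     ∎
    where
    open ℕₚ.≤-Reasoning
    swap : ∀ x y z → x * (y * z) ≡ y * (x * z)
    swap = ℕ-Solver.solve-∀

  vecs : List A → ∀ n → List (Vec A n)
  vecs xs zero    = [] ∷ []
  vecs xs (suc n) = cartesianProductWith _∷_ xs (vecs xs n)

  length≡∑1 : ∀ (xs : List A) → length xs ≡ ∑ xs (λ _ → 1)
  length≡∑1 xs = sym (trans (∑-const xs 1) (ℕₚ.*-identityʳ (length xs)))

  length-cartesianProductWith : ∀ (g : A → B → C) xs ys → length (cartesianProductWith g xs ys) ≡ length xs * length ys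
  length-cartesianProductWith g xs ys = begin
    length (cartesianProductWith g xs ys)   ≡⟨ length≡∑1 (cartesianProductWith g xs ys) ⟩
    ∑ (cartesianProductWith g xs ys) (λ _ → 1) ≡⟨ ∑-cartesianProductWith g xs ys (λ _ → 1) ⟩
    ∑ xs (λ _ → ∑ ys (λ _ → 1))             ≡⟨ ∑-const xs _ ⟩
    length xs * ∑ ys (λ _ → 1)              ≡⟨ cong (length xs *_) (sym (length≡∑1 ys)) ⟩
    length xs * length ys                   ∎
    where open ≡-Reasoning

  length-vecs : ∀ (xs : List A) n → length (vecs xs n) ≡ length xs ^ n
  length-vecs xs zero    = refl
  length-vecs xs (suc n) = trans (length-cartesianProductWith _∷_ xs (vecs xs n)) (cong (length xs *_) (length-vecs xs n))

  vecs-unique : ∀ {xs : List A} → Unique xs → ∀ n → Unique (vecs xs n)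
  vecs-unique u zero    = [] ∷ []
  vecs-unique u (suc n) = Uniqueₚ.cartesianProductWith⁺ _∷_ (λ e → Vecₚ.∷-injectiveˡ e , Vecₚ.∷-injectiveʳ e) u (vecs-unique u n)

  -- The distributive law: the entries of a vector of parameters vary independently, so an average
  -- over vectors is computed one entry at a time.
  ∑-vecs-∏ : ∀ (xs : List A) n (f : Fin n → A → ℕ) →
    ∑ (vecs xs n) (λ v → ∏ (λ i → f i (lookup v i))) ≡ ∏ (λ i → ∑ xs (f i))
  ∑-vecs-∏ xs zero    f = refl
  ∑-vecs-∏ xs (suc n) f = begin
    ∑ (vecs xs (suc n)) (λ v → ∏ (λ i → f i (lookup v i)))
      ≡⟨ ∑-cartesianProductWith _∷_ xs (vecs xs n) _ ⟩
    ∑ xs (λ x → ∑ (vecs xs n) (λ v → f zero x * ∏ (λ i → f (suc i) (lookup v i))))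
      ≡⟨ ∑-cong xs (λ x → trans (∑-*ˡ (vecs xs n) (f zero x) _) (cong (f zero x *_) (∑-vecs-∏ xs n (f ∘ suc)))) ⟩
    ∑ xs (λ x → f zero x * ∏ (λ i → ∑ xs (f (suc i))))
      ≡⟨ ∑-*ʳ xs _ (f zero) ⟩
    ∑ xs (f zero) * ∏ (λ i → ∑ xs (f (suc i))) ∎
    where open ≡-Reasoning

  𝟙 : ∀ {P : Set} → Dec P → ℕ
  𝟙 d = if does d then 1 else 0

  𝟙≤1 : ∀ {P : Set} (d : Dec P) → 𝟙 d ≤ 1
  𝟙≤1 (yes _) = s≤s z≤n
  𝟙≤1 (no  _) = z≤n

  𝟙-yes : ∀ {P : Set} (d : Dec P) → P → 𝟙 d ≡ 1
  𝟙-yes (yes _) p = refl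
  𝟙-yes (no ¬p) p = contradiction p ¬p

  𝟙-no : ∀ {P : Set} (d : Dec P) → ¬ P → 𝟙 d ≡ 0
  𝟙-no (yes p) ¬p = contradiction p ¬p
  𝟙-no (no _)  ¬p = refl

  𝟙≢0 : ∀ {P : Set} (d : Dec P) → 𝟙 d ≢ 0 → P
  𝟙≢0 (yes p) nz = p
  𝟙≢0 (no _)  nz = contradiction refl nz

  𝟙-cong : ∀ {P Q : Set} (d : Dec P) (e : Dec Q) → (P → Q) → (Q → P) → 𝟙 d ≡ 𝟙 e
  𝟙-cong (yes p) e f g = sym (𝟙-yes e (f p))
  𝟙-cong (no ¬p) e f g = sym (𝟙-no e (¬p ∘ g))

  ∑-𝟙≟ : ∀ n (i : Fin n) → ∑ (allFin n) (λ j → 𝟙 (j Finₚ.≟ i)) ≡ 1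
  ∑-𝟙≟ (suc n) zero    = trans (∑-allFin-suc n (λ j → 𝟙 (j Finₚ.≟ zero))) (cong suc (trans (∑-const (allFin n) 0) (ℕₚ.*-zeroʳ (length (allFin n)))))
  ∑-𝟙≟ (suc n) (suc i) = trans (∑-allFin-suc n (λ j → 𝟙 (j Finₚ.≟ suc i)))
    (trans (∑-cong (allFin n) (λ j → 𝟙-cong (suc j Finₚ.≟ suc i) (j Finₚ.≟ i) Finₚ.suc-injective (cong suc))) (∑-𝟙≟ n i))

  length-allFin : ∀ n → length (allFin n) ≡ n
  length-allFin n = Listₚ.length-tabulate id

  ∑-0 : ∀ {A : Set} (xs : List A) {f : A → ℕ} → (∀ x → f x ≡ 0) → ∑ xs f ≡ 0
  ∑-0 xs e = trans (∑-cong xs e) (trans (∑-const xs 0) (ℕₚ.*-zeroʳ (length xs)))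

open FiniteSums

-- The design of all subsets of a given size, and its pair counts.

module BlockDesign where
  open import Data.Nat.Base using (_+_; _*_; _∸_; _^_; _<_)

  ∑-𝟙≟* : ∀ n (i : Fin n) (f : Fin n → ℕ) → ∑ (allFin n) (λ j → 𝟙 (j Finₚ.≟ i) * f j) ≡ f i
  ∑-𝟙≟* n i f = begin
    ∑ (allFin n) (λ j → 𝟙 (j Finₚ.≟ i) * f j) ≡⟨ ∑-cong (allFin n) pointwise ⟩
    ∑ (allFin n) (λ j → 𝟙 (j Finₚ.≟ i) * f i) ≡⟨ ∑-*ʳ (allFin n) (f i) _ ⟩
    ∑ (allFin n) (λ j → 𝟙 (j Finₚ.≟ i)) * f i ≡⟨ cong (_* f i) (∑-𝟙≟ n i) ⟩
    1 * f i                                   ≡⟨ ℕₚ.*-identityˡ (f i) ⟩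
    f i                                       ∎
    where
    open ≡-Reasoning
    pointwise : ∀ j → 𝟙 (j Finₚ.≟ i) * f j ≡ 𝟙 (j Finₚ.≟ i) * f i
    pointwise j with j Finₚ.≟ i
    ... | yes refl = refl
    ... | no  _    = refl

  χ : ∀ {k} → Subset k → Fin k → ℕ
  χ D i = if lookup D i then 1 else 0

  χ-∈ : ∀ {k} {D : Subset k} {i} → i ∈ D → χ D i ≡ 1
  χ-∈ {D = D} {i} i∈D = cong (if_then 1 else 0) (Vecₚ.[]=⇒lookup i∈D)

  χ-∉ : ∀ {k} {D : Subset k} {i} → ¬ (i ∈ D) → χ D i ≡ 0
  χ-∉ {D = D} {i} i∉D with lookup D i in eq
  ... | true  = contradiction (Vecₚ.lookup⇒[]= i D eq) i∉D
  ... | false = refl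

  χ≤1 : ∀ {k} (D : Subset k) i → χ D i ≤ 1
  χ≤1 D i with lookup D i
  ... | true  = s≤s z≤n
  ... | false = z≤n

  χ²≡χ : ∀ {k} (D : Subset k) i → χ D i * χ D i ≡ χ D i
  χ²≡χ D i with lookup D i
  ... | true  = refl
  ... | false = refl

  ∣∣≡∑χ : ∀ {k} (D : Subset k) → Subset.∣ D ∣ ≡ ∑ (allFin k) (χ D)
  ∣∣≡∑χ []                    = refl
  ∣∣≡∑χ {suc k} (true  ∷ D) = trans (cong suc (∣∣≡∑χ D)) (sym (∑-allFin-suc k (χ (true ∷ D))))
  ∣∣≡∑χ {suc k} (false ∷ D) = trans (∣∣≡∑χ D) (sym (∑-allFin-suc k (χ (false ∷ D))))

  -- The pairs are ordered, so a set of size `ℓ` contains `ℓ * ℓ ∸ ℓ` of them and no halving occurs.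
  offDiagonal : ∀ k → (Fin k → Fin k → ℕ) → ℕ
  offDiagonal k f = ∑ (allFin k) λ i → ∑ (allFin k) λ j → 𝟙 (¬? (j Finₚ.≟ i)) * f i j

  offDiagonal-cong : ∀ {k} {f g : Fin k → Fin k → ℕ} → (∀ {i j} → i ≢ j → f i j ≡ g i j) →
    offDiagonal k f ≡ offDiagonal k g
  offDiagonal-cong {k} {f} {g} e = ∑-cong (allFin k) λ i → ∑-cong (allFin k) (pointwise i)
    where
    pointwise : ∀ i j → 𝟙 (¬? (j Finₚ.≟ i)) * f i j ≡ 𝟙 (¬? (j Finₚ.≟ i)) * g i j
    pointwise i j with j Finₚ.≟ i
    ... | yes _  = refl
    ... | no j≢i = cong (1 *_) (e (j≢i ∘ sym))

  offDiagonal-mono : ∀ {k} {f g : Fin k → Fin k → ℕ} → (∀ {i j} → i ≢ j → f i j ≤ g i j) →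
    offDiagonal k f ≤ offDiagonal k g
  offDiagonal-mono {k} {f} {g} e = ∑-mono (allFin k) λ i → ∑-mono (allFin k) (pointwise i)
    where
    pointwise : ∀ i j → 𝟙 (¬? (j Finₚ.≟ i)) * f i j ≤ 𝟙 (¬? (j Finₚ.≟ i)) * g i j
    pointwise i j with j Finₚ.≟ i
    ... | yes _  = z≤n
    ... | no j≢i = ℕₚ.*-monoʳ-≤ 1 (e (j≢i ∘ sym))

  offDiagonal-* : ∀ {k} (f : Fin k → Fin k → ℕ) c → offDiagonal k (λ i j → f i j * c) ≡ offDiagonal k f * c
  offDiagonal-* {k} f c =
    trans (∑-cong (allFin k) λ i → trans (∑-cong (allFin k) λ j → sym (ℕₚ.*-assoc (𝟙 (¬? (j Finₚ.≟ i))) (f i j) c))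
                                        (∑-*ʳ (allFin k) c _))
          (∑-*ʳ (allFin k) c _)

  ∑-offDiagonal : ∀ {A : Set} {k} (xs : List A) (f : A → Fin k → Fin k → ℕ) →
    ∑ xs (λ x → offDiagonal k (f x)) ≡ offDiagonal k (λ i j → ∑ xs (λ x → f x i j))
  ∑-offDiagonal {k = k} xs f =
    trans (∑-swap xs (allFin k) _) (∑-cong (allFin k) λ i →
    trans (∑-swap xs (allFin k) _) (∑-cong (allFin k) λ j → ∑-*ˡ xs (𝟙 (¬? (j Finₚ.≟ i))) (λ x → f x i j)))

  -- By idempotence the second summand on the left is the missing diagonal; the full double sum then
  -- factors.
  offDiagonal-idempotent : ∀ {k} (a : Fin k → ℕ) → (∀ i → a i * a i ≡ a i) →
    offDiagonal k (λ i j → a i * a j) + ∑ (allFin k) a ≡ ∑ (allFin k) a * ∑ (allFin k) a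
  offDiagonal-idempotent {k} a idem = begin
    offDiagonal k (λ i j → a i * a j) + ∑ (allFin k) a
      ≡⟨ sym (∑-distrib-+ (allFin k) _ a) ⟩
    ∑ (allFin k) (λ i → ∑ (allFin k) (λ j → 𝟙 (¬? (j Finₚ.≟ i)) * (a i * a j)) + a i)
      ≡⟨ ∑-cong (allFin k) row ⟩
    ∑ (allFin k) (λ i → a i * ∑ (allFin k) a)
      ≡⟨ ∑-*ʳ (allFin k) _ a ⟩
    ∑ (allFin k) a * ∑ (allFin k) a ∎
    where
    open ≡-Reasoning
    split : ∀ i j → 𝟙 (¬? (j Finₚ.≟ i)) * (a i * a j) + 𝟙 (j Finₚ.≟ i) * (a i * a j) ≡ a i * a j
    split i j with j Finₚ.≟ i
    ... | yes _ = ℕₚ.*-identityˡ _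
    ... | no  _ = trans (ℕₚ.+-identityʳ _) (ℕₚ.*-identityˡ _)
    row : ∀ i → ∑ (allFin k) (λ j → 𝟙 (¬? (j Finₚ.≟ i)) * (a i * a j)) + a i ≡ a i * ∑ (allFin k) a
    row i = begin
      ∑ (allFin k) (λ j → 𝟙 (¬? (j Finₚ.≟ i)) * (a i * a j)) + a i
        ≡⟨ cong (∑ (allFin k) (λ j → 𝟙 (¬? (j Finₚ.≟ i)) * (a i * a j)) +_)
                (sym (trans (∑-𝟙≟* k i (λ j → a i * a j)) (idem i))) ⟩
      ∑ (allFin k) (λ j → 𝟙 (¬? (j Finₚ.≟ i)) * (a i * a j)) + ∑ (allFin k) (λ j → 𝟙 (j Finₚ.≟ i) * (a i * a j))
        ≡⟨ sym (∑-distrib-+ (allFin k) _ _) ⟩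
      ∑ (allFin k) (λ j → 𝟙 (¬? (j Finₚ.≟ i)) * (a i * a j) + 𝟙 (j Finₚ.≟ i) * (a i * a j))
        ≡⟨ ∑-cong (allFin k) (split i) ⟩
      ∑ (allFin k) (λ j → a i * a j)
        ≡⟨ ∑-*ˡ (allFin k) (a i) a ⟩
      a i * ∑ (allFin k) a ∎

  offDiagonal-χ : ∀ {k} (D : Subset k) → offDiagonal k (λ i j → χ D i * χ D j) + Subset.∣ D ∣ ≡ Subset.∣ D ∣ * Subset.∣ D ∣
  offDiagonal-χ D rewrite ∣∣≡∑χ D = offDiagonal-idempotent (χ D) (χ²≡χ D)

  subsets : ∀ k → ℕ → List (Subset k)
  subsets zero    zero    = [] ∷ []
  subsets zero    (suc ℓ) = []
  subsets (suc k) zero    = List.map (outside ∷_) (subsets k zero)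
  subsets (suc k) (suc ℓ) = List.map (inside ∷_) (subsets k ℓ) ++ List.map (outside ∷_) (subsets k (suc ℓ))

  subsets-size : ∀ k ℓ → All (λ D → Subset.∣ D ∣ ≡ ℓ) (subsets k ℓ)
  subsets-size zero    zero    = refl ∷ []
  subsets-size zero    (suc ℓ) = []
  subsets-size (suc k) zero    = Allₚ.map⁺ (subsets-size k zero)
  subsets-size (suc k) (suc ℓ) = Allₚ.++⁺ (Allₚ.map⁺ (All.map (cong suc) (subsets-size k ℓ))) (Allₚ.map⁺ (subsets-size k (suc ℓ)))

  ∑-subsets : ∀ k ℓ (f : Subset (suc k) → ℕ) →
    ∑ (subsets (suc k) (suc ℓ)) f ≡ ∑ (subsets k ℓ) (f ∘ (inside ∷_)) + ∑ (subsets k (suc ℓ)) (f ∘ (outside ∷_))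
  ∑-subsets k ℓ f = trans (∑-++ (List.map (inside ∷_) (subsets k ℓ)) _ f)
    (cong₂ _+_ (∑-map _ (subsets k ℓ) f) (∑-map _ (subsets k (suc ℓ)) f))

  length-subsets : ∀ k ℓ → length (subsets (suc k) (suc ℓ)) ≡ length (subsets k ℓ) + length (subsets k (suc ℓ))
  length-subsets k ℓ = trans (Listₚ.length-++ (List.map (inside ∷_) (subsets k ℓ)))
    (cong₂ _+_ (Listₚ.length-map _ (subsets k ℓ)) (Listₚ.length-map _ (subsets k (suc ℓ))))

  subsets-nonempty : ∀ {k ℓ} → ℓ ≤ k → 1 ≤ length (subsets k ℓ)
  subsets-nonempty {zero}  {zero}  z≤n     = s≤s z≤n
  subsets-nonempty {suc k} {zero}  z≤n     = subst (1 ≤_) (sym (Listₚ.length-map _ (subsets k 0))) (subsets-nonempty {k} z≤n)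
  subsets-nonempty {suc k} {suc ℓ} (s≤s p) = subst (1 ≤_) (sym (length-subsets k ℓ)) (ℕₚ.≤-trans (subsets-nonempty p) (ℕₚ.m≤m+n _ _))

  ∑-subsets₀-χ : ∀ k i → ∑ (subsets k 0) (λ D → χ D i) ≡ 0
  ∑-subsets₀-χ (suc k) zero    = trans (∑-map _ (subsets k 0) _) (∑-0 (subsets k 0) (λ _ → refl))
  ∑-subsets₀-χ (suc k) (suc i) = trans (∑-map _ (subsets k 0) _) (∑-subsets₀-χ k i)

  degree₁ : ∀ k ℓ i → ∑ (subsets (suc k) (suc ℓ)) (λ D → χ D i) ≡ length (subsets k ℓ)
  degree₁ k ℓ zero = begin
    ∑ (subsets (suc k) (suc ℓ)) (λ D → χ D zero)          ≡⟨ ∑-subsets k ℓ _ ⟩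
    ∑ (subsets k ℓ) (λ _ → 1) + ∑ (subsets k (suc ℓ)) (λ _ → 0)
      ≡⟨ cong₂ _+_ (sym (length≡∑1 (subsets k ℓ))) (∑-0 (subsets k (suc ℓ)) (λ _ → refl)) ⟩
    length (subsets k ℓ) + 0                              ≡⟨ ℕₚ.+-identityʳ _ ⟩
    length (subsets k ℓ)                                  ∎
    where open ≡-Reasoning
  degree₁ (suc k) zero    (suc i) = trans (∑-subsets (suc k) 0 _)
    (trans (cong₂ _+_ (∑-subsets₀-χ (suc k) i) (degree₁ k 0 i)) (sym (Listₚ.length-map _ (subsets k 0))))
  degree₁ (suc k) (suc ℓ) (suc i) = trans (∑-subsets (suc k) (suc ℓ) _)
    (trans (cong₂ _+_ (degree₁ k ℓ i) (degree₁ k (suc ℓ) i)) (sym (length-subsets k ℓ)))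

  ∑-subsets₁-χχ : ∀ k {i j} → i ≢ j → ∑ (subsets k 1) (λ D → χ D i * χ D j) ≡ 0
  ∑-subsets₁-χχ (suc k) {zero}  {zero}  i≢j = contradiction refl i≢j
  ∑-subsets₁-χχ (suc k) {zero}  {suc j} i≢j = trans (∑-subsets k 0 _)
    (cong₂ _+_ (trans (∑-cong (subsets k 0) (λ D → ℕₚ.*-identityˡ _)) (∑-subsets₀-χ k j)) (∑-0 (subsets k 1) (λ _ → refl)))
  ∑-subsets₁-χχ (suc k) {suc i} {zero}  i≢j = trans (∑-subsets k 0 _)
    (cong₂ _+_ (trans (∑-cong (subsets k 0) (λ D → ℕₚ.*-identityʳ _)) (∑-subsets₀-χ k i)) (∑-0 (subsets k 1) (λ D → ℕₚ.*-zeroʳ (χ D i))))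
  ∑-subsets₁-χχ (suc k) {suc i} {suc j} i≢j = trans (∑-subsets k 0 _)
    (cong₂ _+_ (trans (∑-*-0 k) refl) (∑-subsets₁-χχ k (i≢j ∘ cong suc)))
    where
    ∑-*-0 : ∀ k {i j : Fin k} → ∑ (subsets k 0) (λ D → χ D i * χ D j) ≡ 0
    ∑-*-0 (suc k) {zero}  {j}     = trans (∑-map _ (subsets k 0) _) (∑-0 (subsets k 0) (λ _ → refl))
    ∑-*-0 (suc k) {suc i} {zero}  = trans (∑-map _ (subsets k 0) _) (∑-0 (subsets k 0) (λ D → ℕₚ.*-zeroʳ (χ D i)))
    ∑-*-0 (suc k) {suc i} {suc j} = trans (∑-map _ (subsets k 0) _) (∑-*-0 k)

  -- A block through a pair is the pair together with an `ℓ`-subset of the other `k` points. The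
  -- induction follows Pascal's rule and drops to `degree₁` once one of the two points is the first.
  -- The common value is the `M` of the limit `E / M`.
  degree₂ : ∀ k ℓ {i j} → i ≢ j → ∑ (subsets (2 + k) (2 + ℓ)) (λ D → χ D i * χ D j) ≡ length (subsets k ℓ)
  degree₂ k ℓ {zero}  {zero}  i≢j = contradiction refl i≢j
  degree₂ k ℓ {zero}  {suc j} i≢j = trans (∑-subsets (suc k) (suc ℓ) _) (trans (cong₂ _+_
    (trans (∑-cong (subsets (suc k) (suc ℓ)) (λ D → ℕₚ.*-identityˡ _)) (degree₁ k ℓ j))
    (∑-0 (subsets (suc k) (2 + ℓ)) (λ _ → refl))) (ℕₚ.+-identityʳ _))
  degree₂ k ℓ {suc i} {zero}  i≢j = trans (∑-subsets (suc k) (suc ℓ) _) (trans (cong₂ _+_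
    (trans (∑-cong (subsets (suc k) (suc ℓ)) (λ D → ℕₚ.*-identityʳ _)) (degree₁ k ℓ i))
    (∑-0 (subsets (suc k) (2 + ℓ)) (λ D → ℕₚ.*-zeroʳ (χ D i)))) (ℕₚ.+-identityʳ _))
  degree₂ zero    ℓ {suc zero} {suc zero} i≢j = contradiction refl i≢j
  degree₂ (suc k) zero    {suc i} {suc j} i≢j = trans (∑-subsets (2 + k) 1 _)
    (trans (cong₂ _+_ (∑-subsets₁-χχ (2 + k) (i≢j ∘ cong suc)) (degree₂ k 0 (i≢j ∘ cong suc))) (sym (Listₚ.length-map _ (subsets k 0))))
  degree₂ (suc k) (suc ℓ) {suc i} {suc j} i≢j = trans (∑-subsets (2 + k) (2 + ℓ) _)
    (trans (cong₂ _+_ (degree₂ k ℓ (i≢j ∘ cong suc)) (degree₂ k (suc ℓ) (i≢j ∘ cong suc))) (sym (length-subsets k ℓ)))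

  -- For `p = χ i * χ j` this numbers the blocks through a pair consecutively from 0, which yields
  -- labels below the pair degree.
  rank : ∀ {A : Set} → (A → ℕ) → (xs : List A) → Fin (length xs) → ℕ
  rank p (x ∷ xs) zero    = 0
  rank p (x ∷ xs) (suc e) = p x + rank p xs e

  rank-< : ∀ {A : Set} (p : A → ℕ) xs e → p (List.lookup xs e) ≡ 1 → rank p xs e < ∑ xs p
  rank-< p (x ∷ xs) zero    px≡1 rewrite px≡1 = s≤s z≤n
  rank-< p (x ∷ xs) (suc e) pe≡1 = ℕₚ.+-monoʳ-< (p x) (rank-< p xs e pe≡1)

  rank-injective : ∀ {A : Set} (p : A → ℕ) xs {e e′} → p (List.lookup xs e) ≡ 1 → p (List.lookup xs e′) ≡ 1 →
    rank p xs e ≡ rank p xs e′ → e ≡ e′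
  rank-injective p (x ∷ xs) {zero}  {zero}   pe pe′ eq = refl
  rank-injective p (x ∷ xs) {zero}  {suc e′} pe pe′ eq rewrite pe with () ← eq
  rank-injective p (x ∷ xs) {suc e} {zero}   pe pe′ eq rewrite pe′ with () ← eq
  rank-injective p (x ∷ xs) {suc e} {suc e′} pe pe′ eq = cong suc (rank-injective p xs pe pe′ (ℕₚ.+-cancelˡ-≡ (p x) _ _ eq))

  rank-cong : ∀ {A : Set} {p q : A → ℕ} → (∀ x → p x ≡ q x) → ∀ xs e → rank p xs e ≡ rank q xs e
  rank-cong eq (x ∷ xs) zero    = refl
  rank-cong eq (x ∷ xs) (suc e) = cong₂ _+_ (eq x) (rank-cong eq xs e)

open BlockDesign

-- Upper bound: double counting over coordinate planes.

module PlaneCounting where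
  open import Data.Nat.Base using (_+_; _*_; _∸_; _^_; _<_)

  lookup-ext : ∀ {A : Set} {n} {xs ys : Vec A n} → (∀ i → lookup xs i ≡ lookup ys i) → xs ≡ ys
  lookup-ext {xs = xs} {ys} e = trans (sym (Vecₚ.tabulate∘lookup xs)) (trans (Vecₚ.tabulate-cong e) (Vecₚ.tabulate∘lookup ys))

  AgreeOff : ∀ {A : Set} {k} → Fin k → Fin k → Vec A k → Vec A k → Set
  AgreeOff i j P Q = ∀ d → d ≢ i → d ≢ j → lookup P d ≡ lookup Q d

  covers-line : ∀ {n k ℓ} (r : Rook n k ℓ) {Q i} → i ∈ dirs r →
    (∀ d → d ≢ i → lookup Q d ≡ lookup (pos r) d) → Covers r Q
  covers-line r {Q} {i} i∈D agree with lookup Q i Finₚ.≟ lookup (pos r) i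
  ... | no  ≢i = inj₂ (i , i∈D , ≢i , agree)
  ... | yes ≡i = inj₁ (lookup-ext pointwise)
    where
    pointwise : ∀ d → lookup Q d ≡ lookup (pos r) d
    pointwise d with d Finₚ.≟ i
    ... | yes refl = ≡i
    ... | no  d≢i  = agree d d≢i

  -- The common point takes coordinate `j` from `s` and all others from `r`: it lies on the line
  -- through `r` in direction `j` and on the line through `s` in direction `i`.
  plane-overlap : ∀ {n k ℓ} (r s : Rook n k ℓ) {i j} → i ≢ j → j ∈ dirs r → i ∈ dirs s →
    AgreeOff i j (pos r) (pos s) → ∃ λ Q → Covers r Q × Covers s Q
  plane-overlap {n} {k} r s {i} {j} i≢j j∈r i∈s agree = Q , covers-line r j∈r off-r , covers-line s i∈s off-s
    where
    Q : Point n k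
    Q = pos r [ j ]≔ lookup (pos s) j
    off-r : ∀ d → d ≢ j → lookup Q d ≡ lookup (pos r) d
    off-r d d≢j = Vecₚ.lookup∘updateAt′ d j d≢j (pos r)
    off-s : ∀ d → d ≢ i → lookup Q d ≡ lookup (pos s) d
    off-s d d≢i with d Finₚ.≟ j
    ... | yes refl = Vecₚ.lookup∘updateAt j (pos r)
    ... | no  d≢j  = trans (off-r d d≢j) (agree d d≢i d≢j)

  AllPairs-lookup : ∀ {A : Set} {R : A → A → Set} → Symmetric R → ∀ {xs} → AllPairs R xs →
    ∀ {a b} → a ≢ b → R (List.lookup xs a) (List.lookup xs b)
  AllPairs-lookup s (_  ∷ _ ) {zero}  {zero}  a≢b = contradiction refl a≢b
  AllPairs-lookup s (rs ∷ _ ) {zero}  {suc b} a≢b = All.lookup rs (∈-lookup b)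
  AllPairs-lookup s (rs ∷ _ ) {suc a} {zero}  a≢b = s (All.lookup rs (∈-lookup a))
  AllPairs-lookup s (_  ∷ ps) {suc a} {suc b} a≢b = AllPairs-lookup s ps (a≢b ∘ cong suc)

  funToFin-injective : ∀ {m n} {f g : Fin m → Fin n} → funToFin f ≡ funToFin g → ∀ i → f i ≡ g i
  funToFin-injective {f = f} {g} eq i =
    trans (sym (Finₚ.finToFun-funToFin f i)) (trans (cong (λ u → finToFun u i) eq) (Finₚ.finToFun-funToFin g i))

  -- By `plane-overlap`, rooks having both directions lie in different `(i , j)`-planes, and `n ^ k`
  -- such planes exist.
  plane-bound : ∀ {n k ℓ} (rs : List (Rook n (2 + k) ℓ)) → ValidPlacement rs → ∀ {i j} → i ≢ j →
    ∑ rs (λ r → χ (dirs r) i * χ (dirs r) j) ≤ n ^ k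
  plane-bound {n} {k} {ℓ} rs (_ , disjoint) {i} {j} i≢j =
    ℕₚ.≤-trans (∑≤length-support rs weight weight≤1) (Finₚ.injective⇒≤ {f = plane} plane-injective)
    where
    weight : Rook n (2 + k) ℓ → ℕ
    weight r = χ (dirs r) i * χ (dirs r) j
    weight≤1 : ∀ r → weight r ≤ 1
    weight≤1 r = ℕₚ.*-mono-≤ (χ≤1 (dirs r) i) (χ≤1 (dirs r) j)
    Disjoint : Rook n (2 + k) ℓ → Rook n (2 + k) ℓ → Set
    Disjoint r s = ∀ Q → ¬ (Covers r Q × Covers s Q)
    rs-disjoint : AllPairs Disjoint rs
    rs-disjoint = subst (AllPairs Disjoint) (Listₚ.tabulate-lookup rs) (AllPairsₚ.tabulate⁺ (λ a≢b → disjoint _ _ a≢b))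
    ss : List (Rook n (2 + k) ℓ)
    ss = filter (λ r → ¬? (weight r ℕₚ.≟ 0)) rs
    ss-disjoint : AllPairs Disjoint ss
    ss-disjoint = AllPairsₚ.filter⁺ (λ r → ¬? (weight r ℕₚ.≟ 0)) rs-disjoint
    ss-weight : ∀ a → weight (List.lookup ss a) ≢ 0
    ss-weight a = All.lookup (Allₚ.all-filter (λ r → ¬? (weight r ℕₚ.≟ 0)) rs) (∈-lookup a)
    -- After the removal of `i`, coordinate `j` sits at `j′`. Deleting both leaves exactly the
    -- coordinates that name the `(i , j)`-plane.
    j′ : Fin (suc k)
    j′ = punchOut i≢j
    cut : Point n (2 + k) → Point n k
    cut P = removeAt (removeAt P i) j′
    lookup-cut : ∀ P {d} (i≢d : i ≢ d) (j′≢ : j′ ≢ punchOut i≢d) → lookup (cut P) (punchOut j′≢) ≡ lookup P d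
    lookup-cut P i≢d j′≢ = trans (Vecₚ.removeAt-punchOut (removeAt P i) j′≢) (Vecₚ.removeAt-punchOut P i≢d)
    cut-agree : ∀ P Q → (∀ d → lookup (cut P) d ≡ lookup (cut Q) d) → AgreeOff i j P Q
    cut-agree P Q eq d d≢i d≢j = trans (sym (lookup-cut P i≢d j′≢)) (trans (eq _) (lookup-cut Q i≢d j′≢))
      where
      i≢d : i ≢ d
      i≢d = d≢i ∘ sym
      j′≢ : j′ ≢ punchOut i≢d
      j′≢ e = d≢j (sym (Finₚ.punchOut-injective i≢j i≢d e))
    plane : Fin (length ss) → Fin (n ^ k)
    plane a = funToFin (lookup (cut (pos (List.lookup ss a))))
    χ≢0 : ∀ {k} (D : Subset k) d → χ D d ≢ 0 → d ∈ D
    χ≢0 D d nz with lookup D d in eq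
    ... | true  = Vecₚ.lookup⇒[]= d D eq
    ... | false = contradiction refl nz
    plane-injective : ∀ {a b} → plane a ≡ plane b → a ≡ b
    plane-injective {a} {b} eq with a Finₚ.≟ b
    ... | yes a≡b = a≡b
    ... | no  a≢b = contradiction
            (proj₂ (plane-overlap r s i≢j
              (χ≢0 (dirs r) j (λ e → ss-weight a (trans (cong (χ (dirs r) i *_) e) (ℕₚ.*-zeroʳ (χ (dirs r) i)))))
              (χ≢0 (dirs s) i (λ e → ss-weight b (cong (_* χ (dirs s) j) e)))
              (cut-agree (pos r) (pos s) (funToFin-injective eq))))
            (AllPairs-lookup (λ dis Q (p , q) → dis Q (q , p)) ss-disjoint a≢b _)
      where
      r s : Rook n (2 + k) ℓ
      r = List.lookup ss a
      s = List.lookup ss b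

  -- Double counting of pairs consisting of a rook and an ordered pair of its directions: by rooks
  -- on the left, by direction pairs with `plane-bound` on the right.
  rooks-upper-bound : ∀ {n k ℓ} (rs : List (Rook n (2 + k) ℓ)) → ValidPlacement rs →
    length rs * (ℓ * ℓ ∸ ℓ) ≤ offDiagonal (2 + k) (λ _ _ → 1) * n ^ k
  rooks-upper-bound {n} {k} {ℓ} rs valid = begin
    length rs * (ℓ * ℓ ∸ ℓ)
      ≡⟨ sym (∑-const rs (ℓ * ℓ ∸ ℓ)) ⟩
    ∑ rs (λ _ → ℓ * ℓ ∸ ℓ)
      ≡⟨ ∑-cong rs (λ r → sym (pairs r)) ⟩
    ∑ rs (λ r → offDiagonal (2 + k) (λ i j → χ (dirs r) i * χ (dirs r) j))
      ≡⟨ ∑-offDiagonal rs (λ r i j → χ (dirs r) i * χ (dirs r) j) ⟩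
    offDiagonal (2 + k) (λ i j → ∑ rs (λ r → χ (dirs r) i * χ (dirs r) j))
      ≤⟨ offDiagonal-mono (plane-bound rs valid) ⟩
    offDiagonal (2 + k) (λ _ _ → n ^ k)
      ≡⟨ offDiagonal-cong {2 + k} (λ _ → sym (ℕₚ.*-identityˡ (n ^ k))) ⟩
    offDiagonal (2 + k) (λ _ _ → 1 * n ^ k)
      ≡⟨ offDiagonal-* {2 + k} (λ _ _ → 1) (n ^ k) ⟩
    offDiagonal (2 + k) (λ _ _ → 1) * n ^ k ∎
    where
    open ℕₚ.≤-Reasoning
    pairs : ∀ r → offDiagonal (2 + k) (λ i j → χ (dirs r) i * χ (dirs r) j) ≡ ℓ * ℓ ∸ ℓ
    pairs r = trans (sym (ℕₚ.m+n∸n≡m _ ℓ))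
      (cong (_∸ ℓ) (subst (λ s → offDiagonal (2 + k) (λ i j → χ (dirs r) i * χ (dirs r) j) + s ≡ s * s) (size r) (offDiagonal-χ (dirs r))))

  -- The same double count, now exact and applied to blocks. It identifies the constant of
  -- `rooks-upper-bound` with `E / M`.
  subsets-pairs : ∀ k ℓ → length (subsets (2 + k) (2 + ℓ)) * ((2 + ℓ) * (2 + ℓ) ∸ (2 + ℓ))
                        ≡ offDiagonal (2 + k) (λ _ _ → 1) * length (subsets k ℓ)
  subsets-pairs k ℓ = begin
    length Ds * ((2 + ℓ) * (2 + ℓ) ∸ (2 + ℓ))
      ≡⟨ sym (∑-const Ds _) ⟩
    ∑ Ds (λ _ → (2 + ℓ) * (2 + ℓ) ∸ (2 + ℓ))
      ≡⟨ ∑-All (subsets-size (2 + k) (2 + ℓ)) ⟩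
    ∑ Ds (λ D → offDiagonal (2 + k) (λ i j → χ D i * χ D j))
      ≡⟨ ∑-offDiagonal Ds (λ D i j → χ D i * χ D j) ⟩
    offDiagonal (2 + k) (λ i j → ∑ Ds (λ D → χ D i * χ D j))
      ≡⟨ offDiagonal-cong (λ i≢j → trans (degree₂ k ℓ i≢j) (sym (ℕₚ.*-identityˡ _))) ⟩
    offDiagonal (2 + k) (λ _ _ → 1 * length (subsets k ℓ))
      ≡⟨ offDiagonal-* {2 + k} (λ _ _ → 1) (length (subsets k ℓ)) ⟩
    offDiagonal (2 + k) (λ _ _ → 1) * length (subsets k ℓ) ∎
    where
    open ≡-Reasoning
    Ds : List (Subset (2 + k))
    Ds = subsets (2 + k) (2 + ℓ)
    ∑-All : ∀ {ks m} {xs : List (Subset ks)} → All (λ D → Subset.∣ D ∣ ≡ m) xs →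
      ∑ xs (λ _ → m * m ∸ m) ≡ ∑ xs (λ D → offDiagonal ks (λ i j → χ D i * χ D j))
    ∑-All []               = refl
    ∑-All {xs = D ∷ _} (refl ∷ ps) = cong₂ _+_ (trans (cong (_∸ Subset.∣ D ∣) (sym (offDiagonal-χ D))) (ℕₚ.m+n∸n≡m _ Subset.∣ D ∣)) (∑-All ps)

open PlaneCounting

-- Integer sums, congruences and windows of residues.

open import Data.Integer.Base using (+_; 0ℤ; 1ℤ; -_; _+_; _-_; _*_)

∑ℤ : ∀ {n} → (Fin n → ℤ) → ℤ
∑ℤ {zero}  f = 0ℤ
∑ℤ {suc n} f = f zero + ∑ℤ (f ∘ suc)

∑ℤ-cong : ∀ {n} {f g : Fin n → ℤ} → (∀ i → f i ≡ g i) → ∑ℤ f ≡ ∑ℤ g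
∑ℤ-cong {zero}  e = refl
∑ℤ-cong {suc n} e = cong₂ _+_ (e zero) (∑ℤ-cong (e ∘ suc))

∑ℤ-+ : ∀ {n} (f g : Fin n → ℤ) → ∑ℤ (λ i → f i + g i) ≡ ∑ℤ f + ∑ℤ g
∑ℤ-+ {zero}  f g = refl
∑ℤ-+ {suc n} f g = trans (cong (λ s → f zero + g zero + s) (∑ℤ-+ (f ∘ suc) (g ∘ suc))) (step (f zero) (g zero) _ _)
  where
  step : ∀ a b c d → a + b + (c + d) ≡ a + c + (b + d)
  step = solve-∀

∑ℤ-- : ∀ {n} (f g : Fin n → ℤ) → ∑ℤ (λ i → f i - g i) ≡ ∑ℤ f - ∑ℤ g
∑ℤ-- {zero}  f g = refl
∑ℤ-- {suc n} f g = trans (cong (λ s → f zero - g zero + s) (∑ℤ-- (f ∘ suc) (g ∘ suc))) (step (f zero) (g zero) _ _)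
  where
  step : ∀ a b c d → a - b + (c - d) ≡ a + c - (b + d)
  step = solve-∀

∑ℤ-*ˡ : ∀ {n} c (f : Fin n → ℤ) → ∑ℤ (λ i → c * f i) ≡ c * ∑ℤ f
∑ℤ-*ˡ {zero}  c f = sym (ℤₚ.*-zeroʳ c)
∑ℤ-*ˡ {suc n} c f = trans (cong (λ z → c * f zero + z) (∑ℤ-*ˡ c (f ∘ suc))) (sym (ℤₚ.*-distribˡ-+ c (f zero) _))

∑ℤ-difference₁ : ∀ {n} (f g : Fin n → ℤ) i → (∀ d → d ≢ i → f d ≡ g d) → ∑ℤ f - ∑ℤ g ≡ f i - g i
∑ℤ-difference₁ {suc n} f g zero    e rewrite ∑ℤ-cong {f = f ∘ suc} {g ∘ suc} (λ d → e (suc d) (λ ())) = cancel (f zero) (g zero) _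
  where
  cancel : ∀ a b s → a + s - (b + s) ≡ a - b
  cancel = solve-∀
∑ℤ-difference₁ {suc n} f g (suc i) e rewrite e zero (λ ()) =
  trans (cancel (g zero) _ _) (∑ℤ-difference₁ (f ∘ suc) (g ∘ suc) i (λ d d≢i → e (suc d) (d≢i ∘ Finₚ.suc-injective)))
  where
  cancel : ∀ a s t → a + s - (a + t) ≡ s - t
  cancel = solve-∀

-- Meant for two points of one `(i , j)`-plane: every linear form then compares them through two
-- digits only.
∑ℤ-difference₂ : ∀ {n} (f g : Fin n → ℤ) {i j} → i ≢ j → (∀ d → d ≢ i → d ≢ j → f d ≡ g d) →
  ∑ℤ f - ∑ℤ g ≡ (f i - g i) + (f j - g j)
∑ℤ-difference₂ {suc n} f g {zero}  {zero}  i≢j e = contradiction refl i≢j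
∑ℤ-difference₂ {suc n} f g {zero}  {suc j} i≢j e =
  trans (split (f zero) (g zero) _ _) (cong (λ s → (f zero - g zero) + s) (∑ℤ-difference₁ (f ∘ suc) (g ∘ suc) j (λ d d≢j → e (suc d) (λ ()) (d≢j ∘ Finₚ.suc-injective))))
  where
  split : ∀ a b s t → a + s - (b + t) ≡ a - b + (s - t)
  split = solve-∀
∑ℤ-difference₂ {suc n} f g {suc i} {zero}  i≢j e =
  trans (∑ℤ-difference₂ f g {zero} {suc i} (i≢j ∘ sym) (λ d p q → e d q p)) (ℤₚ.+-comm (f zero - g zero) (f (suc i) - g (suc i)))
∑ℤ-difference₂ {suc n} f g {suc i} {suc j} i≢j e rewrite e zero (λ ()) (λ ()) =
  trans (cancel (g zero) _ _) (∑ℤ-difference₂ (f ∘ suc) (g ∘ suc) (i≢j ∘ cong suc)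
    (λ d p q → e (suc d) (p ∘ Finₚ.suc-injective) (q ∘ Finₚ.suc-injective)))
  where
  cancel : ∀ a s t → a + s - (a + t) ≡ s - t
  cancel = solve-∀

∣-linear : ∀ {m a b z} p q → m ∣ a → m ∣ b → z ≡ p * a + q * b → m ∣ z
∣-linear p q m∣a m∣b refl = ∣m∣n⇒∣m+n (∣n⇒∣m*n p m∣a) (∣n⇒∣m*n q m∣b)

∣-difference : ∀ {m a b z} → m ∣ a → m ∣ b → z ≡ a - b → m ∣ z
∣-difference m∣a m∣b refl = ℤ∣.∣m∣n⇒∣m-n m∣a m∣b

∣-∑ℤ : ∀ {m n} (f : Fin n → ℤ) → (∀ i → m ∣ f i) → m ∣ ∑ℤ f
∣-∑ℤ {n = zero}  f d = divides 0ℤ refl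
∣-∑ℤ {n = suc n} f d = ∣m∣n⇒∣m+n (d zero) (∣-∑ℤ (f ∘ suc) (d ∘ suc))

∣-%ℕ : ∀ z m .{{_ : ℕ.NonZero m}} → + m ∣ z - + (z %ℕ m)
∣-%ℕ z m = divides (z /ℕ m) (trans (cong (_- + (z %ℕ m)) (a≡a%ℕn+[a/ℕn]*n z m)) (cancel (+ (z %ℕ m)) _))
  where
  cancel : ∀ r s → r + s - r ≡ s
  cancel = solve-∀

-- The absolute difference is at most the maximum of `a` and `b`, hence below `m`, and 0 is the only
-- multiple of `m` there.
<∧∣-difference⇒≡ : ∀ {m a b} → a ℕ.< m → b ℕ.< m → + m ∣ + a - + b → a ≡ b
<∧∣-difference⇒≡ {m} {a} {b} a<m b<m m∣a-b = ℤₚ.+-injective (ℤₚ.i-j≡0⇒i≡j (+ a) (+ b) (ℤₚ.∣i∣≡0⇒i≡0 ∣a-b∣≡0))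
  where
  ∣a-b∣<m : ℤ.∣ + a - + b ∣ ℕ.< m
  ∣a-b∣<m = ℕₚ.≤-<-trans (subst (λ z → ℤ.∣ z ∣ ℕ.≤ a ℕ.⊔ b) (sym (ℤₚ.m-n≡m⊖n a b)) (ℤₚ.∣m⊝n∣≤m⊔n a b)) (ℕₚ.⊔-pres-<m a<m b<m)
  ∣a-b∣≡0 : ℤ.∣ + a - + b ∣ ≡ 0
  ∣a-b∣≡0 with ℤ.∣ + a - + b ∣ | ∣a-b∣<m | ∣⇒∣ᵤ m∣a-b
  ... | zero  | _   | _   = refl
  ... | suc _ | lt  | dv  = contradiction dv (ℕ∣.>⇒∤ lt)

%ℕ-unique : ∀ {z m r} .{{_ : ℕ.NonZero m}} → r ℕ.< m → + m ∣ z - + r → z %ℕ m ≡ r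
%ℕ-unique {z} {m} {r} r<m m∣z-r = <∧∣-difference⇒≡ (n%ℕd<d z m) r<m (∣-difference m∣z-r (∣-%ℕ z m) (eq z (+ r) _))
  where
  eq : ∀ z r s → s - r ≡ z - r - (z - s)
  eq = solve-∀

module _ (m : ℕ) .{{_ : ℕ.NonZero m}} where

  -- Width 1 expresses a congruence and width `W` the hash condition; one count, `window-count`,
  -- averages both.
  window : ℕ → ℤ → ℕ
  window w z = 𝟙 (z %ℕ m ℕₚ.<? w)

  window≤1 : ∀ w z → window w z ℕ.≤ 1
  window≤1 w z = 𝟙≤1 (z %ℕ m ℕₚ.<? w)

  window≢0⇒< : ∀ w z → window w z ≢ 0 → z %ℕ m ℕ.< w
  window≢0⇒< w z = 𝟙≢0 (z %ℕ m ℕₚ.<? w)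

  window₁≢0⇒∣ : ∀ z → window 1 z ≢ 0 → + m ∣ z
  window₁≢0⇒∣ z nz = subst (+ m ∣_) (trans (cong (λ r → z - + r) (ℕₚ.n<1⇒n≡0 (window≢0⇒< 1 z nz))) (ℤₚ.+-identityʳ z)) (∣-%ℕ z m)

  ∣⇒window₁≡1 : ∀ z → + m ∣ z → window 1 z ≡ 1
  ∣⇒window₁≡1 z m∣z = 𝟙-yes (z %ℕ m ℕₚ.<? 1)
    (subst (ℕ._< 1) (sym (%ℕ-unique {z} (ℕ.>-nonZero⁻¹ m) (subst (+ m ∣_) (sym (ℤₚ.+-identityʳ z)) m∣z))) (s≤s z≤n))

  window-suc : ∀ w z → window (suc w) z ≡ 𝟙 (z %ℕ m ℕₚ.≟ w) ℕ.+ window w z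
  window-suc w z with z %ℕ m ℕₚ.≟ w
  ... | yes eq = trans (𝟙-yes (z %ℕ m ℕₚ.<? suc w) (subst (ℕ._< suc w) (sym eq) ℕₚ.≤-refl))
                       (sym (cong₂ ℕ._+_ (𝟙-yes (z %ℕ m ℕₚ.≟ w) eq) (𝟙-no (z %ℕ m ℕₚ.<? w) (λ lt → ℕₚ.<-irrefl eq lt))))
  ... | no neq = trans (𝟙-cong (z %ℕ m ℕₚ.<? suc w) (z %ℕ m ℕₚ.<? w) (λ lt → ℕₚ.≤∧≢⇒< (ℕₚ.≤-pred lt) neq) ℕₚ.m<n⇒m<1+n)
                       (cong (ℕ._+ window w z) (sym (𝟙-no (z %ℕ m ℕₚ.≟ w) neq)))

  residue-count : ∀ z {r} → r ℕ.< m → ∑ (allFin m) (λ v → 𝟙 ((z - + toℕ v) %ℕ m ℕₚ.≟ r)) ≡ 1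
  residue-count z {r} r<m = trans (∑-cong (allFin m) (λ v → 𝟙-cong ((z - + toℕ v) %ℕ m ℕₚ.≟ r) (v Finₚ.≟ v₀) (to v) (from v))) (∑-𝟙≟ m v₀)
    where
    v₀ : Fin m
    v₀ = fromℕ< (n%ℕd<d (z - + r) m)
    toℕv₀ : toℕ v₀ ≡ (z - + r) %ℕ m
    toℕv₀ = Finₚ.toℕ-fromℕ< _
    swap : ∀ z r v → z - r - v ≡ z - v - r
    swap = solve-∀
    to : ∀ v → (z - + toℕ v) %ℕ m ≡ r → v ≡ v₀
    to v eq = Finₚ.toℕ-injective (sym (trans toℕv₀ (%ℕ-unique {z - + r} (Finₚ.toℕ<n v)
      (subst (+ m ∣_) (trans (cong (λ s → z - + toℕ v - + s) eq) (sym (swap z (+ r) (+ toℕ v)))) (∣-%ℕ (z - + toℕ v) m)))))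
    from : ∀ v → v ≡ v₀ → (z - + toℕ v) %ℕ m ≡ r
    from v refl = %ℕ-unique {z - + toℕ v₀} r<m
      (subst (+ m ∣_) (trans (cong (λ s → z - + r - + s) (sym toℕv₀)) (swap z (+ r) (+ toℕ v₀))) (∣-%ℕ (z - + r) m))

  -- As `v` runs through the residues, so does `z - v`, each being hit once. The count does not
  -- depend on `z`, which is why averaging over right-hand sides treats all cells alike.
  window-count : ∀ z {w} → w ℕ.≤ m → ∑ (allFin m) (λ v → window w (z - + toℕ v)) ≡ w
  window-count z {zero}  w≤m = ∑-0 (allFin m) (λ v → 𝟙-no ((z - + toℕ v) %ℕ m ℕₚ.<? 0) (λ ()))
  window-count z {suc w} w≤m = begin
    ∑ (allFin m) (λ v → window (suc w) (z - + toℕ v))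
      ≡⟨ ∑-cong (allFin m) (λ v → window-suc w (z - + toℕ v)) ⟩
    ∑ (allFin m) (λ v → 𝟙 ((z - + toℕ v) %ℕ m ℕₚ.≟ w) ℕ.+ window w (z - + toℕ v))
      ≡⟨ ∑-distrib-+ (allFin m) _ _ ⟩
    ∑ (allFin m) (λ v → 𝟙 ((z - + toℕ v) %ℕ m ℕₚ.≟ w)) ℕ.+ ∑ (allFin m) (λ v → window w (z - + toℕ v))
      ≡⟨ cong₂ ℕ._+_ (residue-count z w≤m) (window-count z (ℕₚ.<⇒≤ w≤m)) ⟩
    suc w ∎
    where open ≡-Reasoning

*≢0 : ∀ {a b} → a ℕ.* b ≢ 0 → a ≢ 0 × b ≢ 0
*≢0 {a} {b} nz = (λ e → nz (cong (ℕ._* b) e)) , (λ e → nz (trans (cong (a ℕ.*_) e) (ℕₚ.*-zeroʳ a)))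

block-< : ∀ {w a b ρ} σ → ρ ℕ.< w → a ℕ.< b → ρ ℕ.+ w ℕ.* a ℕ.< σ ℕ.+ w ℕ.* b
block-< {w} {a} {b} {ρ} σ ρ<w a<b = begin-strict
  ρ ℕ.+ w ℕ.* a   <⟨ ℕₚ.+-monoˡ-< (w ℕ.* a) ρ<w ⟩
  w ℕ.+ w ℕ.* a   ≡⟨ sym (ℕₚ.*-suc w a) ⟩
  w ℕ.* suc a     ≤⟨ ℕₚ.*-monoʳ-≤ w a<b ⟩
  w ℕ.* b         ≤⟨ ℕₚ.m≤n+m (w ℕ.* b) σ ⟩
  σ ℕ.+ w ℕ.* b   ∎
  where open ℕₚ.≤-Reasoning

-- With `w = W` this reads a label off a hash; with `w = 3` it recovers `d` from an entry of a
-- `Spread` vector.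
quotient-unique : ∀ {w a b ρ σ} → ρ ℕ.< w → σ ℕ.< w → ρ ℕ.+ w ℕ.* a ≡ σ ℕ.+ w ℕ.* b → a ≡ b
quotient-unique {w} {a} {b} {ρ} {σ} ρ<w σ<w eq with ℕₚ.<-cmp a b
... | tri< a<b _ _ = contradiction eq (ℕₚ.<⇒≢ (block-< σ ρ<w a<b))
... | tri≈ _ a≡b _ = a≡b
... | tri> _ _ b<a = contradiction (sym eq) (ℕₚ.<⇒≢ (block-< ρ σ<w b<a))

-- Invertibility of `δ` modulo `m`, in the form of a cancellation law.
Cancels : ℕ → ℤ → Set
Cancels m δ = ∀ u → + m ∣ δ * u → + m ∣ u

-- A homogeneous Vandermonde system: subtracting `b` times the first equation from the second leaves
-- `(a - b) * u`.
solve₂ : ∀ {m} a b u v → Cancels m (a - b) → + m ∣ u + v → + m ∣ a * u + b * v → + m ∣ u × + m ∣ v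
solve₂ {m} a b u v cancels m∣₁ m∣₂ = m∣u , ∣-difference m∣₁ m∣u (eq₂ u v)
  where
  eq₁ : ∀ a b u v → (a - b) * u ≡ 1ℤ * (a * u + b * v) + - b * (u + v)
  eq₁ = solve-∀
  eq₂ : ∀ u v → v ≡ u + v - u
  eq₂ = solve-∀
  m∣u : + m ∣ u
  m∣u = cancels u (∣-linear 1ℤ (- b) m∣₂ m∣₁ (eq₁ a b u v))

-- Lower bound: the congruences selecting the rooks, and their separation.

module Packing
  (m : ℕ) .{{_ : ℕ.NonZero m}} {k E r : ℕ} (D : Fin E → Subset k)
  (α : Fin r → Fin k → ℤ) (shift : Fin r → Fin E → ℤ) (β : Fin k → ℤ) (W : ℕ)
  where

  Cell : Set
  Cell = Vec (Fin (m ℕ.^ suc r)) k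

  -- In order: `ξ` and `η` for the coarse equations, `γ` for the start of the hash window, `s` for
  -- `fine₀`, common to all blocks, and `t` with one entry per block for `fine₁`.
  Parameter : Set
  Parameter = Vec (Fin m) r × Vec (Fin m) r × Fin m × Fin m × Vec (Fin m) E

  coordinate : Fin (suc r) → Cell → Fin k → ℤ
  coordinate c P d = + toℕ (finToFun {m} {suc r} (lookup P d) c)

  fine : Cell → Fin k → ℤ
  fine = coordinate zero

  coarse : Fin r → Cell → Fin k → ℤ
  coarse c = coordinate (suc c)

  sum₀ : Fin E → Fin r → Cell → ℤ
  sum₀ e c P = ∑ℤ (coarse c P) - shift c e

  sum₁ : Fin r → Cell → ℤ
  sum₁ c P = ∑ℤ (λ d → α c d * coarse c P d)

  sum₂ : Fin r → Cell → ℤ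
  sum₂ c P = ∑ℤ (λ d → α c d * α c d * coarse c P d)

  -- Summed over all coarse digits, because a pair's label arises only as a total of contributions
  -- from several components.
  hash : Cell → ℤ
  hash P = ∑ℤ (λ c → sum₂ c P)

  fine₀ : Fin E → Cell → ℤ
  fine₀ e P = ∑ℤ (λ d → + χ (D e) d * fine P d)

  fine₁ : Fin E → Cell → ℤ
  fine₁ e P = ∑ℤ (λ d → + χ (D e) d * β d * fine P d)

  -- The coefficient of the fine digit at `i` cancels. Digits outside `D e` never occur, so for `j`
  -- outside `D e` the value is constant on every `(i , j)`-plane.
  eliminated : Fin E → Fin k → Cell → ℤ
  eliminated e i P = fine₁ e P - β i * fine₀ e P

  onCode : Fin E → Cell → Fin m → ℕ
  onCode e P v = window m 1 (fine₁ e P - + toℕ v)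

  offCode : Fin E → Fin k → Cell → Fin m → Fin m → ℕ
  offCode e i P s v = 1 ℕ.∸ window m 1 (eliminated e i P + β i * + toℕ s - + toℕ v)

  -- Only the test of the rook's own block is selective, passed by one of the `m` values of `v`; the
  -- test of another block fails for at most `k` of them.
  codeTest : ∀ {e e′ : Fin E} → Dec (e′ ≡ e) → Cell → Fin m → Fin m → ℕ
  codeTest {e′ = e′} (yes _) P s v = onCode e′ P v
  codeTest {e′ = e′} (no  _) P s v = ∏ (λ i → offCode e′ i P s v)

  -- A product of 0/1 factors, so that its sum over parameters can be taken factor by factor; its
  -- non-vanishing yields `Good`.
  weight : Parameter → Cell × Fin E → ℕ
  weight (ξ , η , γ , s , t) (P , e) =
    ∏ (λ c → window m 1 (sum₀ e c P - + toℕ (lookup ξ c))) ℕ.*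
    (∏ (λ c → window m 1 (sum₁ c P - + toℕ (lookup η c))) ℕ.*
    (window m W (hash P - + toℕ γ) ℕ.*
    (window m 1 (fine₀ e P - + toℕ s) ℕ.*
    ∏ (λ e′ → codeTest (e′ Finₚ.≟ e) P s (lookup t e′)))))

  record Good (ω : Parameter) (P : Cell) (e : Fin E) : Set where
    private
      ξ = proj₁ ω
      η = proj₁ (proj₂ ω)
      γ = proj₁ (proj₂ (proj₂ ω))
      s = proj₁ (proj₂ (proj₂ (proj₂ ω)))
      t = proj₂ (proj₂ (proj₂ (proj₂ ω)))
    field
      on₀     : ∀ c → + m ∣ sum₀ e c P - + toℕ (lookup ξ c)
      on₁     : ∀ c → + m ∣ sum₁ c P - + toℕ (lookup η c)
      hash<   : (hash P - + toℕ γ) %ℕ m ℕ.< W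
      onFine₀ : + m ∣ fine₀ e P - + toℕ s
      onFine₁ : + m ∣ fine₁ e P - + toℕ (lookup t e)
      off     : ∀ {e′} → e′ ≢ e → ∀ i → ¬ (+ m ∣ eliminated e′ i P + β i * + toℕ s - + toℕ (lookup t e′))
  open Good

  weight≢0⇒good : ∀ ω {P e} → weight ω (P , e) ≢ 0 → Good ω P e
  weight≢0⇒good ω@(ξ , η , γ , s , t) {P} {e} nz = record
    { on₀     = λ c → window₁≢0⇒∣ m _ (∏≢0⇒≢0 _ (proj₁ nz₀) c)
    ; on₁     = λ c → window₁≢0⇒∣ m _ (∏≢0⇒≢0 _ (proj₁ nz₁) c)
    ; hash<   = window≢0⇒< m W (hash P - + toℕ γ) (proj₁ nz₂)
    ; onFine₀ = window₁≢0⇒∣ m _ (proj₁ nz₃)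
    ; onFine₁ = same
    ; off     = other
    }
    where
    nz₀ = *≢0 {∏ (λ c → window m 1 (sum₀ e c P - + toℕ (lookup ξ c)))} nz
    nz₁ = *≢0 {∏ (λ c → window m 1 (sum₁ c P - + toℕ (lookup η c)))} (proj₂ nz₀)
    nz₂ = *≢0 {window m W (hash P - + toℕ γ)} (proj₂ nz₁)
    nz₃ = *≢0 {window m 1 (fine₀ e P - + toℕ s)} (proj₂ nz₂)
    tests : ∀ e′ → codeTest (e′ Finₚ.≟ e) P s (lookup t e′) ≢ 0
    tests = ∏≢0⇒≢0 (λ e′ → codeTest (e′ Finₚ.≟ e) P s (lookup t e′)) (proj₂ nz₃)
    same : + m ∣ fine₁ e P - + toℕ (lookup t e)
    same with e Finₚ.≟ e | tests e
    ... | yes _  | nz′ = window₁≢0⇒∣ m _ nz′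
    ... | no e≢e | _   = contradiction refl e≢e
    other : ∀ {e′} → e′ ≢ e → ∀ i → ¬ (+ m ∣ eliminated e′ i P + β i * + toℕ s - + toℕ (lookup t e′))
    other {e′} e′≢e i m∣ with e′ Finₚ.≟ e | tests e′
    ... | yes e′≡e | _   = e′≢e e′≡e
    ... | no  _    | nz′ = ∏≢0⇒≢0 (λ i → offCode e′ i P s (lookup t e′)) nz′ i (cong (1 ℕ.∸_) (∣⇒window₁≡1 m _ m∣))

  -- Base-`m` digits lie below `m`, so congruent digits are equal, and the digits determine the
  -- coordinate.
  coordinates-injective : ∀ {P Q d} → (∀ c → + m ∣ coordinate c P d - coordinate c Q d) → lookup P d ≡ lookup Q d
  coordinates-injective {P} {Q} {d} m∣ = trans (sym (Finₚ.funToFin-finToFin {suc r} {m} (lookup P d)))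
    (trans (funToFin-cong {suc r} {m} (λ c → Finₚ.toℕ-injective (<∧∣-difference⇒≡
             (Finₚ.toℕ<n (finToFun {m} {suc r} (lookup P d) c)) (Finₚ.toℕ<n (finToFun {m} {suc r} (lookup Q d) c)) (m∣ c))))
           (Finₚ.funToFin-finToFin {suc r} {m} (lookup Q d)))
    where
    funToFin-cong : ∀ {a b} {f g : Fin a → Fin b} → (∀ i → f i ≡ g i) → funToFin f ≡ funToFin g
    funToFin-cong {zero}  eq = refl
    funToFin-cong {suc a} eq = cong₂ combine (eq zero) (funToFin-cong (eq ∘ suc))

  coordinate-agree : ∀ c {i j P Q} → AgreeOff i j P Q → ∀ d → d ≢ i → d ≢ j → coordinate c P d ≡ coordinate c Q d
  coordinate-agree c agree d d≢i d≢j = cong (λ u → + toℕ (finToFun {m} {suc r} u c)) (agree d d≢i d≢j)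

  module Separation
    (label : Fin E → Fin k → Fin k → ℕ) (B : ℕ) (W*B≤m : W ℕ.* B ℕ.≤ m)
    (label-shift : ∀ e {i j} → i ≢ j → ∑ℤ (λ c → α c i * α c j * shift c e) ≡ + (W ℕ.* label e i j))
    (label-< : ∀ {e i j} → i ≢ j → i ∈ D e → j ∈ D e → label e i j ℕ.< B)
    (label-injective : ∀ {e e′ i j} → i ∈ D e → j ∈ D e → i ∈ D e′ → j ∈ D e′ → label e i j ≡ label e′ i j → e ≡ e′)
    (α-cancels : ∀ c {i j} → i ≢ j → Cancels m (α c i - α c j))
    (β-cancels : ∀ {i j} → i ≢ j → Cancels m (β i - β j))
    where

    module _ {ω : Parameter} {P Q : Cell} {e f : Fin E} {i j : Fin k} (i≢j : i ≢ j) (agree : AgreeOff i j P Q) where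

      private
        ξ = proj₁ ω
        η = proj₁ (proj₂ ω)
        γ = proj₁ (proj₂ (proj₂ ω))
        s = proj₁ (proj₂ (proj₂ (proj₂ ω)))
        t = proj₂ (proj₂ (proj₂ (proj₂ ω)))

      u v : Fin (suc r) → ℤ
      u c = coordinate c P i - coordinate c Q i
      v c = coordinate c P j - coordinate c Q j

      weighted-difference : ∀ (a : Fin k → ℤ) c →
        ∑ℤ (λ d → a d * coordinate c P d) - ∑ℤ (λ d → a d * coordinate c Q d) ≡ a i * u c + a j * v c
      weighted-difference a c = trans
        (∑ℤ-difference₂ _ _ i≢j (λ d d≢i d≢j → cong (a d *_) (coordinate-agree c {P = P} {Q} agree d d≢i d≢j)))
        (factor (a i) (a j) (coordinate c P i) _ (coordinate c P j) _)
        where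
        factor : ∀ p q a b c d → p * a - p * b + (q * c - q * d) ≡ p * (a - b) + q * (c - d)
        factor = solve-∀

      coarse-sum : ∀ c → Good ω P e → Good ω Q f → + m ∣ u (suc c) + v (suc c) - (shift c e - shift c f)
      coarse-sum c gP gQ = ∣-difference (on₀ gP c) (on₀ gQ c)
        (trans (cong (_- (shift c e - shift c f))
                 (sym (∑ℤ-difference₂ (coarse c P) (coarse c Q) i≢j (coordinate-agree (suc c) {P = P} {Q} agree))))
               (rearrange (∑ℤ (coarse c P)) _ (shift c e) (shift c f) (+ toℕ (lookup ξ c))))
        where
        rearrange : ∀ a b p q x → a - b - (p - q) ≡ a - p - x - (b - q - x)
        rearrange = solve-∀

      coarse-moment : ∀ c → Good ω P e → Good ω Q f → + m ∣ α c i * u (suc c) + α c j * v (suc c)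
      coarse-moment c gP gQ = ∣-difference (on₁ gP c) (on₁ gQ c)
        (trans (sym (weighted-difference (α c) (suc c))) (rearrange (sum₁ c P) _ (+ toℕ (lookup η c))))
        where
        rearrange : ∀ a b x → a - b ≡ a - x - (b - x)
        rearrange = solve-∀

      -- x²u + y²v = (x + y)(xu + yv) − xy(u + v): the two hashes differ by the shifts scaled by xy.
      hash-shift : Good ω P e → Good ω Q f →
        + m ∣ (hash P + + (W ℕ.* label e i j)) - (hash Q + + (W ℕ.* label f i j))
      hash-shift gP gQ = subst (+ m ∣_) total (∣-∑ℤ _ component)
        where
        term : Fin r → Fin E → Cell → ℤ
        term c e P = sum₂ c P + α c i * α c j * shift c e
        identity : ∀ x y u v p q a b → a - b ≡ x * x * u + y * y * v →
          a + x * y * p - (b + x * y * q) ≡ (x + y) * (x * u + y * v) + - (x * y) * (u + v - (p - q))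
        identity x y u v p q a b eq = trans (regroup a b _ _) (trans (cong (_+ (x * y * p - x * y * q)) eq) (expand x y u v p q))
          where
          regroup : ∀ a b c d → a + c - (b + d) ≡ a - b + (c - d)
          regroup = solve-∀
          expand : ∀ x y u v p q → x * x * u + y * y * v + (x * y * p - x * y * q) ≡ (x + y) * (x * u + y * v) + - (x * y) * (u + v - (p - q))
          expand = solve-∀
        component : ∀ c → + m ∣ term c e P - term c f Q
        component c = ∣-linear (α c i + α c j) (- (α c i * α c j)) (coarse-moment c gP gQ) (coarse-sum c gP gQ)
          (identity (α c i) (α c j) (u (suc c)) (v (suc c)) (shift c e) (shift c f) (sum₂ c P) (sum₂ c Q)
            (weighted-difference (λ d → α c d * α c d) (suc c)))
        term-sum : ∀ e P → ∑ℤ (λ c → term c e P) ≡ hash P + + (W ℕ.* label e i j)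
        term-sum e P = trans (∑ℤ-+ (λ c → sum₂ c P) (λ c → α c i * α c j * shift c e)) (cong (λ z → hash P + z) (label-shift e i≢j))
        total : ∑ℤ (λ c → term c e P - term c f Q) ≡ (hash P + + (W ℕ.* label e i j)) - (hash Q + + (W ℕ.* label f i j))
        total = trans (∑ℤ-- (λ c → term c e P) (λ c → term c f Q)) (cong₂ _-_ (term-sum e P) (term-sum f Q))

      -- Measured from `γ`, each hash is a remainder below `W`. By `hash-shift` the two numbers
      -- remainder plus `W` times label are congruent modulo `m`. Both are below `W * B ≤ m`, hence
      -- equal, and division by `W` returns the labels.
      same-label : i ∈ D e → j ∈ D e → i ∈ D f → j ∈ D f → Good ω P e → Good ω Q f → label e i j ≡ label f i j
      same-label i∈e j∈e i∈f j∈f gP gQ = quotient-unique (hash< gP) (hash< gQ)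
        (<∧∣-difference⇒≡ (small (hash< gP) (label-< i≢j i∈e j∈e)) (small (hash< gQ) (label-< i≢j i∈f j∈f))
          (∣-difference (hash-shift gP gQ) (∣-difference (∣-%ℕ (hash P - + toℕ γ) m) (∣-%ℕ (hash Q - + toℕ γ) m) refl)
            (rearrange (hash P) (hash Q) (+ toℕ γ) _ _ (+ (W ℕ.* label e i j)) (+ (W ℕ.* label f i j)))))
        where
        small : ∀ {ρ a} → ρ ℕ.< W → a ℕ.< B → ρ ℕ.+ W ℕ.* a ℕ.< m
        small {ρ} {a} ρ<W a<B = ℕₚ.<-≤-trans (ℕₚ.+-monoˡ-< (W ℕ.* a) ρ<W)
          (ℕₚ.≤-trans (ℕₚ.≤-reflexive (sym (ℕₚ.*-suc W a))) (ℕₚ.≤-trans (ℕₚ.*-monoʳ-≤ W a<B) W*B≤m))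
        rearrange : ∀ h h′ g ρ ρ′ l l′ → ρ + l - (ρ′ + l′) ≡ h + l - (h′ + l′) - (h - g - ρ - (h′ - g - ρ′))
        rearrange = solve-∀

      -- In every digit the differences at `i` and `j` solve the system of `solve₂`: for coarse
      -- digits because equal blocks have equal shifts, for the fine digit because `χ` is 1 at both
      -- `i` and `j`.
      same-block : e ≡ f → i ∈ D e → j ∈ D e → Good ω P e → Good ω Q f → P ≡ Q
      same-block refl i∈ j∈ gP gQ = lookup-ext pointwise
        where
        divisible : ∀ c → + m ∣ u c × + m ∣ v c
        divisible (suc c) = solve₂ (α c i) (α c j) (u (suc c)) (v (suc c)) (α-cancels c i≢j)
          (subst (+ m ∣_) (cancel (u (suc c) + v (suc c)) (shift c e)) (coarse-sum c gP gQ)) (coarse-moment c gP gQ)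
          where
          cancel : ∀ x y → x - (y - y) ≡ x
          cancel = solve-∀
        divisible zero = solve₂ (β i) (β j) (u zero) (v zero) (β-cancels i≢j)
          (∣-difference (onFine₀ gP) (onFine₀ gQ) (trans (trans (sym (ones i∈ j∈)) (sym (weighted-difference (λ d → + χ (D e) d) zero)))
             (rearrange (fine₀ e P) _ (+ toℕ s))))
          (∣-difference (onFine₁ gP) (onFine₁ gQ) (trans (trans (sym (betas i∈ j∈)) (sym (weighted-difference (λ d → + χ (D e) d * β d) zero)))
             (rearrange (fine₁ e P) _ (+ toℕ (lookup t e)))))
          where
          rearrange : ∀ a b x → a - b ≡ a - x - (b - x)
          rearrange = solve-∀
          ones : i ∈ D e → j ∈ D e → + χ (D e) i * u zero + + χ (D e) j * v zero ≡ u zero + v zero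
          ones i∈ j∈ rewrite χ-∈ i∈ | χ-∈ j∈ = cong₂ _+_ (ℤₚ.*-identityˡ (u zero)) (ℤₚ.*-identityˡ (v zero))
          betas : i ∈ D e → j ∈ D e → + χ (D e) i * β i * u zero + + χ (D e) j * β j * v zero ≡ β i * u zero + β j * v zero
          betas i∈ j∈ rewrite χ-∈ i∈ | χ-∈ j∈ | ℤₚ.*-identityˡ (β i) | ℤₚ.*-identityˡ (β j) = refl
        pointwise : ∀ d → lookup P d ≡ lookup Q d
        pointwise d with d Finₚ.≟ i | d Finₚ.≟ j
        ... | yes refl | _        = coordinates-injective {P} {Q} (proj₁ ∘ divisible)
        ... | no _     | yes refl = coordinates-injective {P} {Q} (proj₂ ∘ divisible)
        ... | no d≢i   | no d≢j   = agree d d≢i d≢j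

      -- Forgetting coordinate i, the two fine equations of P leave one equation in which j does not occur, so Q satisfies it.
      escapes : j ∉ D e → j ∈ D f → Good ω P e → ¬ Good ω Q f
      escapes j∉e j∈f gP gQ = off gQ e≢f i
        (∣-linear 1ℤ (- β i) (onFine₁ gP) (onFine₀ gP)
          (trans (cong (λ z → z + β i * + toℕ s - + toℕ (lookup t e)) (sym eliminated-agrees))
                 (rearrange (fine₁ e P) (fine₀ e P) (β i) (+ toℕ s) (+ toℕ (lookup t e)))))
        where
        e≢f : e ≢ f
        e≢f refl = j∉e j∈f
        rearrange : ∀ a b x p q → a - x * b + x * p - q ≡ 1ℤ * (a - q) + - x * (b - p)
        rearrange = solve-∀
        eliminated-agrees : eliminated e i P ≡ eliminated e i Q
        eliminated-agrees = ℤₚ.i-j≡0⇒i≡j (eliminated e i P) (eliminated e i Q) (trans (regroup (fine₁ e P) (fine₀ e P) (fine₁ e Q) (fine₀ e Q) (β i))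
          (trans (cong₂ (λ a b → a - β i * b) (weighted-difference (λ d → + χ (D e) d * β d) zero) (weighted-difference (λ d → + χ (D e) d) zero))
          (vanishes j∉e)))
          where
          regroup : ∀ a b a′ b′ x → a - x * b - (a′ - x * b′) ≡ a - a′ - x * (b - b′)
          regroup = solve-∀
          vanishes : j ∉ D e → + χ (D e) i * β i * u zero + + χ (D e) j * β j * v zero
                     - β i * (+ χ (D e) i * u zero + + χ (D e) j * v zero) ≡ 0ℤ
          vanishes j∉e rewrite χ-∉ j∉e = zero-identity (+ χ (D e) i) (β i) (u zero) (β j) (v zero)
            where
            zero-identity : ∀ c x u y v → c * x * u + 0ℤ * y * v - x * (c * u + 0ℤ * v) ≡ 0ℤ
            zero-identity = solve-∀

    -- If one block misses one of the two directions, `escapes` excludes the situation. Otherwise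
    -- both blocks contain the pair, so equal labels force equal blocks, and then equal points.
    good-separated : ∀ {ω P Q e f i j} → i ≢ j → i ∈ D e → j ∈ D f → AgreeOff i j P Q →
      Good ω P e → Good ω Q f → P ≡ Q × e ≡ f
    good-separated {ω} {P} {Q} {e} {f} {i} {j} i≢j i∈e j∈f agree gP gQ with j ∈? D e | i ∈? D f
    ... | no j∉e  | _       = contradiction gQ (escapes {ω} {P} {Q} {e} {f} i≢j agree j∉e j∈f gP)
    -- The previous case with the two rooks interchanged, and with them `i` and `j`.
    ... | yes _   | no i∉f  = contradiction gP (escapes {ω} {Q} {P} {f} {e} (i≢j ∘ sym) (λ d p q → sym (agree d q p)) i∉f i∈e gQ)
    ... | yes j∈e | yes i∈f = same-block {ω} {P} {Q} {e} {f} i≢j agree e≡f i∈e j∈e gP gQ , e≡f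
      where
      e≡f : e ≡ f
      e≡f = label-injective i∈e j∈e i∈f j∈f (same-label {ω} {P} {Q} {e} {f} i≢j agree i∈e j∈e i∈f j∈f gP gQ)

-- Averaging over all right-hand sides.

1≤∏∸+∑ : ∀ {n} (b : Fin n → ℕ) → 1 ℕ.≤ ∏ (λ i → 1 ℕ.∸ b i) ℕ.+ ∑ (allFin n) b
1≤∏∸+∑ {zero}  b = s≤s z≤n
1≤∏∸+∑ {suc n} b = subst (λ t → 1 ℕ.≤ (1 ℕ.∸ b zero) ℕ.* ∏ (λ i → 1 ℕ.∸ b (suc i)) ℕ.+ t) (sym (∑-allFin-suc n b)) (bound (b zero))
  where
  bound : ∀ x → 1 ℕ.≤ (1 ℕ.∸ x) ℕ.* ∏ (λ i → 1 ℕ.∸ b (suc i)) ℕ.+ (x ℕ.+ ∑ (allFin n) (b ∘ suc))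
  bound zero    = subst (λ p → 1 ℕ.≤ p ℕ.+ ∑ (allFin n) (b ∘ suc)) (sym (ℕₚ.*-identityˡ _)) (1≤∏∸+∑ (b ∘ suc))
  bound (suc x) = ℕₚ.≤-trans (s≤s z≤n) (ℕₚ.m≤n+m _ _)

module Counting
  (m : ℕ) .{{_ : ℕ.NonZero m}} {k E r : ℕ} (D : Fin E → Subset k)
  (α : Fin r → Fin k → ℤ) (shift : Fin r → Fin E → ℤ) (β : Fin k → ℤ) (W : ℕ)
  where
  open Packing m D α shift β W

  parameters : List Parameter
  parameters = cartesianProduct (vecs (allFin m) r) (cartesianProduct (vecs (allFin m) r)
    (cartesianProduct (allFin m) (cartesianProduct (allFin m) (vecs (allFin m) E))))

  length-parameters : length parameters ≡ m ℕ.^ r ℕ.* (m ℕ.^ r ℕ.* (m ℕ.* (m ℕ.* m ℕ.^ E)))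
  length-parameters =
    trans (length-cartesianProductWith _,_ (vecs (allFin m) r) _) (cong₂ ℕ._*_ (length-params r)
    (trans (length-cartesianProductWith _,_ (vecs (allFin m) r) _) (cong₂ ℕ._*_ (length-params r)
    (trans (length-cartesianProductWith _,_ (allFin m) _) (cong₂ ℕ._*_ (length-allFin m)
    (trans (length-cartesianProductWith _,_ (allFin m) _) (cong₂ ℕ._*_ (length-allFin m) (length-params E))))))))
    where
    length-params : ∀ n → length (vecs (allFin m) n) ≡ m ℕ.^ n
    length-params n = trans (length-vecs (allFin m) n) (cong (ℕ._^ n) (length-allFin m))

  1≤m : 1 ℕ.≤ m
  1≤m = ℕ.>-nonZero⁻¹ m

  onCode-count : ∀ e P → ∑ (allFin m) (onCode e P) ≡ 1
  onCode-count e P = window-count m (fine₁ e P) 1≤m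

  -- A union bound: for each of the `k` indices `i` exactly one `v` satisfies the eliminated
  -- equation, so at most `k` values are lost.
  offCode-count : ∀ e P s → m ℕ.∸ k ℕ.≤ ∑ (allFin m) (λ v → ∏ (λ i → offCode e i P s v))
  offCode-count e P s = begin
    m ℕ.∸ k
      ≤⟨ ℕₚ.∸-monoˡ-≤ k total ⟩
    ∑ (allFin m) (λ v → ∏ (λ i → offCode e i P s v)) ℕ.+ k ℕ.∸ k
      ≡⟨ ℕₚ.m+n∸n≡m _ k ⟩
    ∑ (allFin m) (λ v → ∏ (λ i → offCode e i P s v)) ∎
    where
    open ℕₚ.≤-Reasoning
    hit : Fin m → Fin k → ℕ
    hit v i = window m 1 (eliminated e i P + β i * + toℕ s - + toℕ v)
    hits : ∑ (allFin m) (λ v → ∑ (allFin k) (hit v)) ≡ k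
    hits = trans (∑-swap (allFin m) (allFin k) hit)
      (trans (∑-cong (allFin k) (λ i → window-count m (eliminated e i P + β i * + toℕ s) 1≤m))
             (trans (sym (length≡∑1 (allFin k))) (length-allFin k)))
    total : m ℕ.≤ ∑ (allFin m) (λ v → ∏ (λ i → offCode e i P s v)) ℕ.+ k
    total = begin
      m                                            ≡⟨ trans (sym (length-allFin m)) (length≡∑1 (allFin m)) ⟩
      ∑ (allFin m) (λ _ → 1)                       ≤⟨ ∑-mono (allFin m) (λ v → 1≤∏∸+∑ (hit v)) ⟩
      ∑ (allFin m) (λ v → ∏ (λ i → offCode e i P s v) ℕ.+ ∑ (allFin k) (hit v))
        ≡⟨ ∑-distrib-+ (allFin m) _ _ ⟩
      ∑ (allFin m) (λ v → ∏ (λ i → offCode e i P s v)) ℕ.+ ∑ (allFin m) (λ v → ∑ (allFin k) (hit v))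
        ≡⟨ cong (∑ (allFin m) (λ v → ∏ (λ i → offCode e i P s v)) ℕ.+_) hits ⟩
      ∑ (allFin m) (λ v → ∏ (λ i → offCode e i P s v)) ℕ.+ k ∎

  tests : Fin E → Cell → Fin m → Vec (Fin m) E → ℕ
  tests e P s t = ∏ (λ e′ → codeTest (e′ Finₚ.≟ e) P s (lookup t e′))

  -- The entries of `t` are independent. The entry at `e` has one admissible value, and the factor
  -- `m` on the right makes up for it; every other entry has at least `m ∸ k`.
  tests-count : ∀ e P s → (m ℕ.∸ k) ℕ.^ E ℕ.≤ m ℕ.* ∑ (vecs (allFin m) E) (tests e P s)
  tests-count e P s = subst (λ t → (m ℕ.∸ k) ℕ.^ E ℕ.≤ m ℕ.* t)
    (sym (∑-vecs-∏ (allFin m) E (λ e′ → codeTest (e′ Finₚ.≟ e) P s)))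
    (^≤*∏ (λ e′ → ∑ (allFin m) (codeTest (e′ Finₚ.≟ e) P s)) (m ℕ.∸ k) m e (ℕₚ.m∸n≤m m k) same other)
    where
    same : ∑ (allFin m) (codeTest (e Finₚ.≟ e) P s) ≡ 1
    same with e Finₚ.≟ e
    ... | yes _  = onCode-count e P
    ... | no e≢e = contradiction refl e≢e
    other : ∀ e′ → e′ ≢ e → m ℕ.∸ k ℕ.≤ ∑ (allFin m) (codeTest (e′ Finₚ.≟ e) P s)
    other e′ e′≢e with e′ Finₚ.≟ e
    ... | yes e′≡e = contradiction e′≡e e′≢e
    ... | no  _    = offCode-count e′ P s

  weight-count : W ℕ.≤ m → ∀ x → W ℕ.* (m ℕ.∸ k) ℕ.^ E ℕ.≤ m ℕ.* ∑ parameters (λ ω → weight ω x)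
  weight-count W≤m (P , e) = begin
    W ℕ.* (m ℕ.∸ k) ℕ.^ E
      ≤⟨ ℕₚ.*-monoʳ-≤ W inner ⟩
    W ℕ.* (m ℕ.* S)
      ≡⟨ rearrange W m S ⟩
    m ℕ.* (1 ℕ.* (1 ℕ.* (W ℕ.* S)))
      ≡⟨ cong (m ℕ.*_) (sym factorised) ⟩
    m ℕ.* ∑ parameters (λ ω → weight ω (P , e)) ∎
    where
    open ℕₚ.≤-Reasoning
    a₀ a₁ : Vec (Fin m) r → ℕ
    a₀ ξ = ∏ (λ c → window m 1 (sum₀ e c P - + toℕ (lookup ξ c)))
    a₁ η = ∏ (λ c → window m 1 (sum₁ c P - + toℕ (lookup η c)))
    a₂ a₃ : Fin m → ℕ
    a₂ γ = window m W (hash P - + toℕ γ)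
    a₃ s = window m 1 (fine₀ e P - + toℕ s)
    -- The tests depend on `s`, so these two sums do not separate; `inner` succeeds because
    -- `tests-count` is uniform in `s`.
    S : ℕ
    S = ∑ (allFin m) (λ s → a₃ s ℕ.* ∑ (vecs (allFin m) E) (tests e P s))
    rearrange : ∀ w m s → w ℕ.* (m ℕ.* s) ≡ m ℕ.* (1 ℕ.* (1 ℕ.* (w ℕ.* s)))
    rearrange = ℕ-Solver.solve-∀
    inner : (m ℕ.∸ k) ℕ.^ E ℕ.≤ m ℕ.* S
    inner = begin
      (m ℕ.∸ k) ℕ.^ E
        ≡⟨ sym (trans (cong (ℕ._* (m ℕ.∸ k) ℕ.^ E) (window-count m (fine₀ e P) 1≤m)) (ℕₚ.*-identityˡ _)) ⟩
      ∑ (allFin m) a₃ ℕ.* (m ℕ.∸ k) ℕ.^ E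
        ≡⟨ sym (∑-*ʳ (allFin m) _ a₃) ⟩
      ∑ (allFin m) (λ s → a₃ s ℕ.* (m ℕ.∸ k) ℕ.^ E)
        ≤⟨ ∑-mono (allFin m) (λ s → ℕₚ.*-monoʳ-≤ (a₃ s) (tests-count e P s)) ⟩
      ∑ (allFin m) (λ s → a₃ s ℕ.* (m ℕ.* ∑ (vecs (allFin m) E) (tests e P s)))
        ≡⟨ ∑-cong (allFin m) (λ s → swap (a₃ s) m _) ⟩
      ∑ (allFin m) (λ s → m ℕ.* (a₃ s ℕ.* ∑ (vecs (allFin m) E) (tests e P s)))
        ≡⟨ ∑-*ˡ (allFin m) m _ ⟩
      m ℕ.* S ∎
      where
      swap : ∀ x y z → x ℕ.* (y ℕ.* z) ≡ y ℕ.* (x ℕ.* z)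
      swap = ℕ-Solver.solve-∀
    factor : ∀ {A B : Set} (xs : List A) (ys : List B) (f : A → ℕ) (g : A → B → ℕ) {T} → (∀ x → ∑ ys (g x) ≡ T) →
      ∑ (cartesianProduct xs ys) (λ z → f (proj₁ z) ℕ.* g (proj₁ z) (proj₂ z)) ≡ ∑ xs f ℕ.* T
    factor xs ys f g {T} eq = trans (∑-cartesianProductWith _,_ xs ys _)
      (trans (∑-cong xs (λ x → trans (∑-*ˡ ys (f x) (g x)) (cong (f x ℕ.*_) (eq x)))) (∑-*ʳ xs T f))
    ones : ∀ (z : Fin r → ℤ) → ∑ (vecs (allFin m) r) (λ ξ → ∏ (λ c → window m 1 (z c - + toℕ (lookup ξ c)))) ≡ 1
    ones z = trans (∑-vecs-∏ (allFin m) r (λ c v → window m 1 (z c - + toℕ v))) (∏≡1 _ (λ c → window-count m (z c) 1≤m))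
    factorised : ∑ parameters (λ ω → weight ω (P , e)) ≡ 1 ℕ.* (1 ℕ.* (W ℕ.* S))
    factorised =
      trans (factor (vecs (allFin m) r) _ a₀ (λ _ ω → a₁ (proj₁ ω) ℕ.* (a₂ (proj₁ (proj₂ ω)) ℕ.* (a₃ (proj₁ (proj₂ (proj₂ ω))) ℕ.* tests e P (proj₁ (proj₂ (proj₂ ω))) (proj₂ (proj₂ (proj₂ ω)))))) (λ _ →
      trans (factor (vecs (allFin m) r) _ a₁ (λ _ ω → a₂ (proj₁ ω) ℕ.* (a₃ (proj₁ (proj₂ ω)) ℕ.* tests e P (proj₁ (proj₂ ω)) (proj₂ (proj₂ ω)))) (λ _ →
      trans (factor (allFin m) _ a₂ (λ _ ω → a₃ (proj₁ ω) ℕ.* tests e P (proj₁ ω) (proj₂ ω)) (λ _ →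
      trans (∑-cartesianProductWith _,_ (allFin m) (vecs (allFin m) E) _) (∑-cong (allFin m) (λ s → ∑-*ˡ (vecs (allFin m) E) (a₃ s) (tests e P s)))))
      (cong (ℕ._* S) (window-count m (hash P) W≤m))))
      (cong (ℕ._* (W ℕ.* S)) (ones (λ c → sum₁ c P)))))
      (cong (ℕ._* (1 ℕ.* (W ℕ.* S))) (ones (λ c → sum₀ e c P)))

  weight≤1 : ∀ ω x → weight ω x ℕ.≤ 1
  weight≤1 (ξ , η , γ , s , t) (P , e) =
    ℕₚ.*-mono-≤ (∏≤1 _ (λ c → window≤1 m 1 (sum₀ e c P - + toℕ (lookup ξ c))))
    (ℕₚ.*-mono-≤ (∏≤1 _ (λ c → window≤1 m 1 (sum₁ c P - + toℕ (lookup η c))))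
    (ℕₚ.*-mono-≤ (window≤1 m W (hash P - + toℕ γ))
    (ℕₚ.*-mono-≤ (window≤1 m 1 (fine₀ e P - + toℕ s))
    (∏≤1 _ (λ e′ → codeTest≤1 e′ (e′ Finₚ.≟ e))))))
    where
    codeTest≤1 : ∀ e′ (d : Dec (e′ ≡ e)) → codeTest d P s (lookup t e′) ℕ.≤ 1
    codeTest≤1 e′ (yes _) = window≤1 m 1 (fine₁ e′ P - + toℕ (lookup t e′))
    codeTest≤1 e′ (no _)  = ∏≤1 _ (λ i → ℕₚ.m∸n≤m 1 (window m 1 (eliminated e′ i P + β i * + toℕ s - + toℕ (lookup t e′))))

-- From separated cells to valid placements.

covers⇒agree : ∀ {n k ℓ} (r : Rook n k ℓ) {Q} → 1 ℕ.≤ ℓ → Covers r Q →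
  ∃ λ i → i ∈ dirs r × (∀ d → d ≢ i → lookup Q d ≡ lookup (pos r) d)
covers⇒agree r 1≤ℓ (inj₂ (i , i∈D , _ , agree)) = i , i∈D , agree
-- The rook's own position lies on each of its lines, so any direction serves.
covers⇒agree r 1≤ℓ (inj₁ refl) = proj₁ (member (dirs r) nonempty) , proj₂ (member (dirs r) nonempty) , λ _ _ → refl
  where
  nonempty : 1 ℕ.≤ Subset.∣ dirs r ∣
  nonempty = subst (1 ℕ.≤_) (sym (size r)) 1≤ℓ
  member : ∀ {k} (D : Subset k) → 1 ℕ.≤ Subset.∣ D ∣ → ∃ λ i → i ∈ D
  member (true  ∷ D) p = zero , Vec.here
  member (false ∷ D) p with member D p
  ... | i , i∈D = suc i , Vec.there i∈D

another-member : ∀ {k} (D : Subset k) → 2 ℕ.≤ Subset.∣ D ∣ → ∀ i → ∃ λ j → j ∈ D × i ≢ j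
another-member D 2≤∣D∣ i with Finₚ.any? (λ j → j ∈? D ×-dec ¬? (i Finₚ.≟ j))
... | yes found = found
... | no  none  = contradiction (ℕₚ.≤-trans 2≤∣D∣ ∣D∣≤1) (λ { (s≤s ()) })
  where
  pointwise : ∀ j → χ D j ℕ.≤ 𝟙 (j Finₚ.≟ i)
  pointwise j with j Finₚ.≟ i | j ∈? D
  ... | yes refl | _       = χ≤1 D j
  ... | no j≢i   | yes j∈D = contradiction (j , j∈D , j≢i ∘ sym) none
  ... | no _     | no j∉D  = ℕₚ.≤-reflexive (χ-∉ j∉D)
  ∣D∣≤1 : Subset.∣ D ∣ ℕ.≤ 1
  ∣D∣≤1 = ℕₚ.≤-trans (ℕₚ.≤-reflexive (∣∣≡∑χ D)) (ℕₚ.≤-trans (∑-mono (allFin _) pointwise) (ℕₚ.≤-reflexive (∑-𝟙≟ _ i)))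

-- Lines through the common point in different directions span the required plane. If the directions
-- coincide, the rooks share a line, and a second direction of `s`, available since `2 ≤ ℓ`, spans a
-- plane containing it.
overlap⇒plane : ∀ {n k ℓ} (r s : Rook n k ℓ) {Q} → 2 ℕ.≤ ℓ → Covers r Q → Covers s Q →
  ∃₂ λ i j → i ∈ dirs r × j ∈ dirs s × i ≢ j × AgreeOff i j (pos r) (pos s)
overlap⇒plane r s {Q} 2≤ℓ r-covers s-covers
  with covers⇒agree r (ℕₚ.<⇒≤ 2≤ℓ) r-covers | covers⇒agree s (ℕₚ.<⇒≤ 2≤ℓ) s-covers
... | i , i∈r , r-agree | j , j∈s , s-agree with i Finₚ.≟ j
... | no i≢j = i , j , i∈r , j∈s , i≢j , λ d d≢i d≢j → trans (sym (r-agree d d≢i)) (s-agree d d≢j)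
... | yes refl with another-member (dirs s) (subst (2 ℕ.≤_) (sym (size s)) 2≤ℓ) i
... | j′ , j′∈s , i≢j′ = i , j′ , i∈r , j′∈s , i≢j′ , λ d d≢i _ → trans (sym (r-agree d d≢i)) (s-agree d d≢i)

AllPairs-strengthen : ∀ {A : Set} {R : A → A → Set} {P : A → Set} {xs} → AllPairs R xs → All P xs →
  AllPairs (λ x y → P x × P y × R x y) xs
AllPairs-strengthen []         []       = []
AllPairs-strengthen (rs ∷ rss) (p ∷ ps) =
  All.zipWith (λ (r , q) → p , q , r) (rs , ps) ∷ AllPairs-strengthen rss ps

module Placement
  (m : ℕ) .{{_ : ℕ.NonZero m}} {k E r : ℕ} (D : Fin E → Subset k)
  (α : Fin r → Fin k → ℤ) (shift : Fin r → Fin E → ℤ) (β : Fin k → ℤ) (W : ℕ) (W≤m : W ℕ.≤ m)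
  (separated : ∀ {ω P Q e f i j} → i ≢ j → i ∈ D e → j ∈ D f → AgreeOff i j P Q →
      Packing.Good m D α shift β W ω P e → Packing.Good m D α shift β W ω Q f → P ≡ Q × e ≡ f)
  {n ℓ : ℕ} (q≤n : m ℕ.^ suc r ℕ.≤ n) (2≤ℓ : 2 ℕ.≤ ℓ) (size-D : ∀ e → Subset.∣ D e ∣ ≡ ℓ)
  where
  open Packing m D α shift β W
  open Counting m D α shift β W

  embed : Cell → Point n k
  embed = Vec.map (λ u → inject≤ u q≤n)

  toRook : Cell × Fin E → Rook n k ℓ
  toRook (P , e) = rook (embed P) (D e) (size-D e)

  cells : List (Cell × Fin E)
  cells = cartesianProduct (vecs (allFin (m ℕ.^ suc r)) k) (allFin E)

  chosen : Parameter → List (Cell × Fin E)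
  chosen ω = filter (λ x → ¬? (weight ω x ℕₚ.≟ 0)) cells

  embed-agree : ∀ {i j P Q} → AgreeOff i j (embed P) (embed Q) → AgreeOff i j P Q
  embed-agree {P = P} {Q} agree d d≢i d≢j = Finₚ.inject≤-injective q≤n q≤n (lookup P d) (lookup Q d)
    (trans (sym (Vecₚ.lookup-map d _ P)) (trans (agree d d≢i d≢j) (Vecₚ.lookup-map d _ Q)))

  Compatible : Rook n k ℓ → Rook n k ℓ → Set
  Compatible r s = pos r ≢ pos s × (∀ Q → ¬ (Covers r Q × Covers s Q))

  compatible : ∀ ω {x y} → weight ω x ≢ 0 → weight ω y ≢ 0 → x ≢ y → Compatible (toRook x) (toRook y)
  compatible ω {x@(P , e)} {y@(P′ , e′)} gx gy x≢y = apart , λ Q (cr , cs) → disjoint Q cr cs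
    where
    disjoint : ∀ Q → Covers (toRook x) Q → ¬ Covers (toRook y) Q
    disjoint Q cr cs with overlap⇒plane (toRook x) (toRook y) 2≤ℓ cr cs
    ... | i , j , i∈ , j∈ , i≢j , agree =
      let P≡P′ , e≡e′ = separated {ω} {P} {P′} {e} {e′} i≢j i∈ j∈ (embed-agree {P = P} {P′} agree) (weight≢0⇒good ω gx) (weight≢0⇒good ω gy)
      in x≢y (cong₂ _,_ P≡P′ e≡e′)
    apart : embed P ≢ embed P′
    apart eq = disjoint (embed P) (inj₁ refl) (inj₁ eq)

  placement : Parameter → List (Rook n k ℓ)
  placement ω = List.map toRook (chosen ω)

  placement-compatible : ∀ ω → AllPairs Compatible (placement ω)
  placement-compatible ω = AllPairsₚ.map⁺ (AllPairs.map (λ (gx , gy , x≢y) → compatible ω gx gy x≢y)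
    (AllPairs-strengthen
      (Uniqueₚ.filter⁺ (λ x → ¬? (weight ω x ℕₚ.≟ 0))
        (Uniqueₚ.cartesianProduct⁺ (vecs-unique (Uniqueₚ.allFin⁺ (m ℕ.^ suc r)) k) (Uniqueₚ.allFin⁺ E)))
      (Allₚ.all-filter (λ x → ¬? (weight ω x ℕₚ.≟ 0)) cells)))

  placement-valid : ∀ ω → ValidPlacement (placement ω)
  placement-valid ω = AllPairsₚ.map⁺ (AllPairs.map proj₁ (placement-compatible ω)) ,
    λ a b a≢b → proj₂ (AllPairs-lookup {R = Compatible} (λ (apart , dis) → (apart ∘ sym) , λ Q (p , q) → dis Q (q , p)) (placement-compatible ω) a≢b)

  -- The total weight is summed in two ways: each cell with a block receives at least the share of
  -- `weight-count`, while each parameter contributes at most the size of its placement, hence at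
  -- most `c`.
  averaged-bound : ∀ c → (∀ (rs : List (Rook n k ℓ)) → ValidPlacement rs → length rs ℕ.≤ c) →
    (m ℕ.^ suc r) ℕ.^ k ℕ.* E ℕ.* (W ℕ.* (m ℕ.∸ k) ℕ.^ E) ℕ.≤
    m ℕ.* (m ℕ.^ r ℕ.* (m ℕ.^ r ℕ.* (m ℕ.* (m ℕ.* m ℕ.^ E))) ℕ.* c)
  averaged-bound c maximal = begin
    (m ℕ.^ suc r) ℕ.^ k ℕ.* E ℕ.* (W ℕ.* (m ℕ.∸ k) ℕ.^ E)
      ≡⟨ cong (ℕ._* (W ℕ.* (m ℕ.∸ k) ℕ.^ E)) (sym length-cells) ⟩
    length cells ℕ.* (W ℕ.* (m ℕ.∸ k) ℕ.^ E)
      ≡⟨ sym (∑-const cells _) ⟩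
    ∑ cells (λ _ → W ℕ.* (m ℕ.∸ k) ℕ.^ E)
      ≤⟨ ∑-mono cells (weight-count W≤m) ⟩
    ∑ cells (λ x → m ℕ.* ∑ parameters (λ ω → weight ω x))
      ≡⟨ ∑-*ˡ cells m _ ⟩
    m ℕ.* ∑ cells (λ x → ∑ parameters (λ ω → weight ω x))
      ≡⟨ cong (m ℕ.*_) (∑-swap cells parameters (λ x ω → weight ω x)) ⟩
    m ℕ.* ∑ parameters (λ ω → ∑ cells (weight ω))
      ≤⟨ ℕₚ.*-monoʳ-≤ m (∑-mono parameters per-parameter) ⟩
    m ℕ.* ∑ parameters (λ _ → c)
      ≡⟨ cong (m ℕ.*_) (trans (∑-const parameters c) (cong (ℕ._* c) length-parameters)) ⟩
    m ℕ.* (m ℕ.^ r ℕ.* (m ℕ.^ r ℕ.* (m ℕ.* (m ℕ.* m ℕ.^ E))) ℕ.* c) ∎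
    where
    open ℕₚ.≤-Reasoning
    length-cells : length cells ≡ (m ℕ.^ suc r) ℕ.^ k ℕ.* E
    length-cells = trans (length-cartesianProductWith _,_ (vecs (allFin (m ℕ.^ suc r)) k) (allFin E))
      (cong₂ ℕ._*_ (trans (length-vecs (allFin (m ℕ.^ suc r)) k) (cong (ℕ._^ k) (length-allFin (m ℕ.^ suc r)))) (length-allFin E))
    per-parameter : ∀ ω → ∑ cells (weight ω) ℕ.≤ c
    per-parameter ω = ℕₚ.≤-trans (∑≤length-support cells (weight ω) (weight≤1 ω))
      (ℕₚ.≤-trans (ℕₚ.≤-reflexive (sym (Listₚ.length-map toRook (chosen ω)))) (maximal (placement ω) (placement-valid ω)))

-- Coefficients and shifts realising the prescribed labels.

≤⇒∣! : ∀ {a n} → a ≢ 0 → a ℕ.≤ n → a ℕ∣.∣ n !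
≤⇒∣! {zero}  a≢0 _   = contradiction refl a≢0
≤⇒∣! {suc a} _   a≤n = ℕ∣.∣-trans (ℕ∣.m∣m*n (a !)) (ℕ∣.m≤n⇒m!∣n! a≤n)

-- If K = gδ and m = 1 + Ky, then u = mu − gy(δu).
cancels : ∀ {K y δ} → ℤ.∣ δ ∣ ℕ∣.∣ K → Cancels (suc (K ℕ.* y)) δ
cancels {K} {y} {δ} δ∣K u m∣δu with ℤ∣.∣ᵤ⇒∣ {δ} {+ K} δ∣K
... | divides g K≡gδ = ∣-linear u (- (g * + y)) (ℤ∣.∣-refl {+ suc (K ℕ.* y)}) m∣δu
  (trans (identity u g (+ y) δ) (cong (λ z → u * z + - (g * + y) * (δ * u)) (sym modulus)))
  where
  identity : ∀ u g y δ → u ≡ u * (1ℤ + g * δ * y) + - (g * y) * (δ * u)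
  identity = solve-∀
  modulus : + suc (K ℕ.* y) ≡ 1ℤ + g * δ * + y
  modulus = cong (λ z → 1ℤ + z) (trans (ℤₚ.pos-* K y) (cong (_* + y) K≡gδ))

-- Spacing 3 keeps the entries distinct while leaving room for two simultaneous unit perturbations,
-- as `gadget` requires.
Spread : ∀ {k} → (Fin k → ℤ) → Set
Spread {k} α = ∀ d → ∃ λ ε → ε ℕ.< 3 × α d ≡ + (ε ℕ.+ 3 ℕ.* toℕ d)

-- The difference is nonzero, since the quotient by 3 recovers the index, and at most `3 * k` in
-- absolute value. It therefore divides the factorial and so `K`.
spread-cancels : ∀ {k K y} {α : Fin k → ℤ} → (3 ℕ.* k) ! ℕ∣.∣ K → Spread α → ∀ {i j} → i ≢ j →
  Cancels (suc (K ℕ.* y)) (α i - α j)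
spread-cancels {k} {K} {y} {α} !∣K spread {i} {j} i≢j with spread i | spread j
... | ε , ε<3 , eq | ζ , ζ<3 , eq′ = cancels {K} {y} {α i - α j} (ℕ∣.∣-trans (≤⇒∣! nonzero bounded) !∣K)
  where
  small : ∀ {ε} → ε ℕ.< 3 → ∀ (d : Fin k) → ε ℕ.+ 3 ℕ.* toℕ d ℕ.≤ 3 ℕ.* k
  small ε<3 d = ℕₚ.≤-trans (ℕₚ.+-monoˡ-≤ (3 ℕ.* toℕ d) (ℕₚ.<⇒≤ ε<3))
    (ℕₚ.≤-trans (ℕₚ.≤-reflexive (sym (ℕₚ.*-suc 3 (toℕ d)))) (ℕₚ.*-monoʳ-≤ 3 (Finₚ.toℕ<n d)))
  nonzero : ℤ.∣ α i - α j ∣ ≢ 0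
  nonzero e = i≢j (Finₚ.toℕ-injective (quotient-unique ε<3 ζ<3
    (ℤₚ.+-injective (trans (sym eq) (trans (ℤₚ.i-j≡0⇒i≡j (α i) (α j) (ℤₚ.∣i∣≡0⇒i≡0 e)) eq′)))))
  bounded : ℤ.∣ α i - α j ∣ ℕ.≤ 3 ℕ.* k
  bounded rewrite eq | eq′ = ℕₚ.≤-trans
    (subst (λ z → ℤ.∣ z ∣ ℕ.≤ (ε ℕ.+ 3 ℕ.* toℕ i) ℕ.⊔ (ζ ℕ.+ 3 ℕ.* toℕ j)) (sym (ℤₚ.m-n≡m⊖n (ε ℕ.+ 3 ℕ.* toℕ i) (ζ ℕ.+ 3 ℕ.* toℕ j)))
      (ℤₚ.∣m⊝n∣≤m⊔n (ε ℕ.+ 3 ℕ.* toℕ i) (ζ ℕ.+ 3 ℕ.* toℕ j)))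
    (ℕₚ.⊔-lub (small ε<3 i) (small ζ<3 j))

∑ℤ-lookup-++ : ∀ {A : Set} (xs ys : List A) (f : A → ℤ) →
  ∑ℤ (f ∘ List.lookup (xs ++ ys)) ≡ ∑ℤ (f ∘ List.lookup xs) + ∑ℤ (f ∘ List.lookup ys)
∑ℤ-lookup-++ []       ys f = sym (ℤₚ.+-identityˡ _)
∑ℤ-lookup-++ (x ∷ xs) ys f = trans (cong (λ z → f x + z) (∑ℤ-lookup-++ xs ys f)) (sym (ℤₚ.+-assoc (f x) _ _))

∑ℤ-lookup-concatMap : ∀ {A B : Set} (g : A → List B) (f : B → ℤ) (h : A → ℕ) →
  (∀ x → ∑ℤ (f ∘ List.lookup (g x)) ≡ + h x) → ∀ xs → ∑ℤ (f ∘ List.lookup (List.concatMap g xs)) ≡ + ∑ xs h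
∑ℤ-lookup-concatMap g f h eq []       = refl
∑ℤ-lookup-concatMap g f h eq (x ∷ xs) = trans (∑ℤ-lookup-++ (g x) (List.concatMap g xs) f)
  (cong₂ _+_ (eq x) (∑ℤ-lookup-concatMap g f h eq xs))

All-concatMap : ∀ {A B : Set} {P : B → Set} (g : A → List B) → (∀ x → All P (g x)) → ∀ xs → All P (List.concatMap g xs)
All-concatMap g h []       = []
All-concatMap g h (x ∷ xs) = Allₚ.++⁺ (h x) (All-concatMap g h xs)

-- The data of one coarse digit: its coefficients, and the block shifts before they are scaled.
Component : ℕ → ℕ → Set
Component k E = (Fin k → ℤ) × (Fin E → ℤ)

-- The second difference of α i * α j in two independent perturbations of α isolates the pair {i₀, j₀}.
gadget : ∀ {k E} → Fin k → Fin k → (Fin E → ℕ) → List (Component k E)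
gadget {k} {E} i₀ j₀ κ =
  ((λ d → + (p d ℕ.+ q d ℕ.+ 3 ℕ.* toℕ d)) , (λ e → + κ e)) ∷
  ((λ d → + (p d ℕ.+ 3 ℕ.* toℕ d)) , (λ e → - (+ κ e))) ∷
  ((λ d → + (q d ℕ.+ 3 ℕ.* toℕ d)) , (λ e → - (+ κ e))) ∷
  ((λ d → + (3 ℕ.* toℕ d)) , (λ e → + κ e)) ∷ []
  where
  p q : Fin k → ℕ
  p d = 𝟙 (i₀ Finₚ.≟ d)
  q d = 𝟙 (j₀ Finₚ.≟ d)

gadget-spread : ∀ {k E} i₀ j₀ (κ : Fin E → ℕ) → All (λ c → Spread {k} (proj₁ c)) (gadget i₀ j₀ κ)
gadget-spread i₀ j₀ κ =
  (λ d → _ , s≤s (ℕₚ.+-mono-≤ (𝟙≤1 (i₀ Finₚ.≟ d)) (𝟙≤1 (j₀ Finₚ.≟ d))) , refl) ∷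
  (λ d → _ , s≤s (ℕₚ.m≤n⇒m≤1+n (𝟙≤1 (i₀ Finₚ.≟ d))) , refl) ∷
  (λ d → _ , s≤s (ℕₚ.m≤n⇒m≤1+n (𝟙≤1 (j₀ Finₚ.≟ d))) , refl) ∷
  (λ d → 0 , s≤s z≤n , refl) ∷ []

contribution : ∀ {k E} → Fin E → Fin k → Fin k → Component k E → ℤ
contribution e i j (α , X) = α i * α j * X e

gadget-contribution : ∀ {k E} (i₀ j₀ : Fin k) (κ : Fin E → ℕ) e i j →
  ∑ℤ (contribution e i j ∘ List.lookup (gadget i₀ j₀ κ)) ≡
  + ((𝟙 (i₀ Finₚ.≟ i) ℕ.* 𝟙 (j₀ Finₚ.≟ j) ℕ.+ 𝟙 (j₀ Finₚ.≟ i) ℕ.* 𝟙 (i₀ Finₚ.≟ j)) ℕ.* κ e)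
gadget-contribution i₀ j₀ κ e i j =
  trans (identity (+ 𝟙 (i₀ Finₚ.≟ i)) (+ 𝟙 (j₀ Finₚ.≟ i)) (+ (3 ℕ.* toℕ i)) (+ 𝟙 (i₀ Finₚ.≟ j)) (+ 𝟙 (j₀ Finₚ.≟ j)) (+ (3 ℕ.* toℕ j)) (+ κ e))
        (sym (trans (ℤₚ.pos-* (𝟙 (i₀ Finₚ.≟ i) ℕ.* 𝟙 (j₀ Finₚ.≟ j) ℕ.+ 𝟙 (j₀ Finₚ.≟ i) ℕ.* 𝟙 (i₀ Finₚ.≟ j)) (κ e))
              (cong (_* + κ e) (cong₂ _+_ (ℤₚ.pos-* (𝟙 (i₀ Finₚ.≟ i)) (𝟙 (j₀ Finₚ.≟ j))) (ℤₚ.pos-* (𝟙 (j₀ Finₚ.≟ i)) (𝟙 (i₀ Finₚ.≟ j)))))))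
  where
  identity : ∀ p q x p′ q′ x′ κ →
    (p + q + x) * (p′ + q′ + x′) * κ + ((p + x) * (p′ + x′) * - κ + ((q + x) * (q′ + x′) * - κ + (x * x′ * κ + 0ℤ)))
    ≡ (p * q′ + q * p′) * κ
  identity = solve-∀

components : ∀ {k E} → (Fin k → Fin k → Fin E → ℕ) → List (Component k E)
components {k} κ = List.concatMap (λ i₀ → List.concatMap (λ j₀ → gadget i₀ j₀ (κ i₀ j₀)) (allFin k)) (allFin k)

components-spread : ∀ {k E} (κ : Fin k → Fin k → Fin E → ℕ) → All (λ c → Spread (proj₁ c)) (components κ)
components-spread {k} κ = All-concatMap (λ i₀ → List.concatMap (λ j₀ → gadget i₀ j₀ (κ i₀ j₀)) (allFin k))
  (λ i₀ → All-concatMap (λ j₀ → gadget i₀ j₀ (κ i₀ j₀)) (λ j₀ → gadget-spread i₀ j₀ (κ i₀ j₀)) (allFin k)) (allFin k)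

-- A gadget at `(i₀ , j₀)` acts only on that pair and its reverse. Of the gadgets at all ordered
-- pairs, those at `(i , j)` and `(j , i)` remain.
components-contribution : ∀ {k E} (κ : Fin k → Fin k → Fin E → ℕ) e i j →
  ∑ℤ (contribution e i j ∘ List.lookup (components κ)) ≡ + (κ i j e ℕ.+ κ j i e)
components-contribution {k} κ e i j = trans
  (∑ℤ-lookup-concatMap (λ i₀ → List.concatMap (λ j₀ → gadget i₀ j₀ (κ i₀ j₀)) (allFin k)) (contribution e i j) _
    (λ i₀ → ∑ℤ-lookup-concatMap (λ j₀ → gadget i₀ j₀ (κ i₀ j₀)) (contribution e i j) _
      (λ j₀ → gadget-contribution i₀ j₀ (κ i₀ j₀) e i j) (allFin k)) (allFin k))
  (cong +_ (trans (∑-cong (allFin k) inner) (trans (∑-distrib-+ (allFin k) _ _)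
    (cong₂ ℕ._+_ (∑-𝟙≟* k i (λ i₀ → κ i₀ j e)) (∑-𝟙≟* k j (λ i₀ → κ i₀ i e))))))
  where
  expand : ∀ a b c d x → (a ℕ.* b ℕ.+ c ℕ.* d) ℕ.* x ≡ a ℕ.* (b ℕ.* x) ℕ.+ d ℕ.* (c ℕ.* x)
  expand = ℕ-Solver.solve-∀
  inner : ∀ i₀ →
    ∑ (allFin k) (λ j₀ → (𝟙 (i₀ Finₚ.≟ i) ℕ.* 𝟙 (j₀ Finₚ.≟ j) ℕ.+ 𝟙 (j₀ Finₚ.≟ i) ℕ.* 𝟙 (i₀ Finₚ.≟ j)) ℕ.* κ i₀ j₀ e) ≡
    𝟙 (i₀ Finₚ.≟ i) ℕ.* κ i₀ j e ℕ.+ 𝟙 (i₀ Finₚ.≟ j) ℕ.* κ i₀ i e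
  inner i₀ = trans (∑-cong (allFin k) (λ j₀ → expand (𝟙 (i₀ Finₚ.≟ i)) (𝟙 (j₀ Finₚ.≟ j)) (𝟙 (j₀ Finₚ.≟ i)) (𝟙 (i₀ Finₚ.≟ j)) (κ i₀ j₀ e)))
    (trans (∑-distrib-+ (allFin k) _ _) (cong₂ ℕ._+_
      (trans (∑-*ˡ (allFin k) (𝟙 (i₀ Finₚ.≟ i)) _) (cong (𝟙 (i₀ Finₚ.≟ i) ℕ.*_) (∑-𝟙≟* k j (λ j₀ → κ i₀ j₀ e))))
      (trans (∑-*ˡ (allFin k) (𝟙 (i₀ Finₚ.≟ j)) _) (cong (𝟙 (i₀ Finₚ.≟ j) ℕ.*_) (∑-𝟙≟* k i (λ j₀ → κ i₀ j₀ e))))))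

-- Inequalities: from sides `m ^ R` to all sides, and from integers to ratios.

[m+K][m∸K]≤m² : ∀ m K → (m ℕ.+ K) ℕ.* (m ℕ.∸ K) ℕ.≤ m ℕ.* m
[m+K][m∸K]≤m² m K with ℕₚ.≤-total m K
... | inj₁ m≤K = subst (ℕ._≤ m ℕ.* m) (sym (trans (cong ((m ℕ.+ K) ℕ.*_) (ℕₚ.m≤n⇒m∸n≡0 m≤K)) (ℕₚ.*-zeroʳ (m ℕ.+ K)))) z≤n
... | inj₂ K≤m with m ℕ.∸ K | ℕₚ.m∸n+n≡m K≤m
... | d | refl = subst ((d ℕ.+ K ℕ.+ K) ℕ.* d ℕ.≤_) (identity d K) (ℕₚ.m≤m+n _ (K ℕ.* K))
  where
  identity : ∀ d K → (d ℕ.+ K ℕ.+ K) ℕ.* d ℕ.+ K ℕ.* K ≡ (d ℕ.+ K) ℕ.* (d ℕ.+ K)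
  identity = ℕ-Solver.solve-∀

-- Bernoulli's inequality for `(1 - K / m) ^ h`, cleared of denominators; truncation makes it
-- trivial once `h * K` reaches `m`.
bernoulli : ∀ m K h → m ℕ.^ h ℕ.* (m ℕ.∸ h ℕ.* K) ℕ.≤ (m ℕ.∸ K) ℕ.^ h ℕ.* m
bernoulli m K zero    = ℕₚ.≤-refl
bernoulli m K (suc h) = begin
  m ℕ.* m ℕ.^ h ℕ.* (m ℕ.∸ (K ℕ.+ h ℕ.* K))     ≡⟨ swap₁ m (m ℕ.^ h) _ ⟩
  m ℕ.^ h ℕ.* (m ℕ.* (m ℕ.∸ (K ℕ.+ h ℕ.* K)))   ≤⟨ ℕₚ.*-monoʳ-≤ (m ℕ.^ h) (step (h ℕ.* K)) ⟩
  m ℕ.^ h ℕ.* ((m ℕ.∸ K) ℕ.* (m ℕ.∸ h ℕ.* K))   ≡⟨ swap₂ (m ℕ.^ h) (m ℕ.∸ K) _ ⟩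
  (m ℕ.∸ K) ℕ.* (m ℕ.^ h ℕ.* (m ℕ.∸ h ℕ.* K))   ≤⟨ ℕₚ.*-monoʳ-≤ (m ℕ.∸ K) (bernoulli m K h) ⟩
  (m ℕ.∸ K) ℕ.* ((m ℕ.∸ K) ℕ.^ h ℕ.* m)         ≡⟨ sym (ℕₚ.*-assoc (m ℕ.∸ K) _ m) ⟩
  (m ℕ.∸ K) ℕ.* (m ℕ.∸ K) ℕ.^ h ℕ.* m           ∎
  where
  open ℕₚ.≤-Reasoning
  swap₁ : ∀ a b c → a ℕ.* b ℕ.* c ≡ b ℕ.* (a ℕ.* c)
  swap₁ = ℕ-Solver.solve-∀
  swap₂ : ∀ a b c → a ℕ.* (b ℕ.* c) ≡ b ℕ.* (a ℕ.* c)
  swap₂ = ℕ-Solver.solve-∀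
  step : ∀ H → m ℕ.* (m ℕ.∸ (K ℕ.+ H)) ℕ.≤ (m ℕ.∸ K) ℕ.* (m ℕ.∸ H)
  step H with ℕₚ.≤-total m (K ℕ.+ H)
  ... | inj₁ m≤ = subst (ℕ._≤ (m ℕ.∸ K) ℕ.* (m ℕ.∸ H)) (sym (trans (cong (m ℕ.*_) (ℕₚ.m≤n⇒m∸n≡0 m≤)) (ℕₚ.*-zeroʳ m))) z≤n
  ... | inj₂ ≤m with m ℕ.∸ (K ℕ.+ H) | ℕₚ.m∸n+n≡m ≤m
  ... | d | refl = begin
    (d ℕ.+ (K ℕ.+ H)) ℕ.* d             ≤⟨ ℕₚ.m≤m+n _ (H ℕ.* K) ⟩
    (d ℕ.+ (K ℕ.+ H)) ℕ.* d ℕ.+ H ℕ.* K ≡⟨ identity d K H ⟩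
    (d ℕ.+ H) ℕ.* (d ℕ.+ K)
      ≡⟨ sym (cong₂ ℕ._*_ (trans (cong (ℕ._∸ K) (shuffle₁ d K H)) (ℕₚ.m+n∸n≡m (d ℕ.+ H) K))
                          (trans (cong (ℕ._∸ H) (shuffle₂ d K H)) (ℕₚ.m+n∸n≡m (d ℕ.+ K) H))) ⟩
    (d ℕ.+ (K ℕ.+ H) ℕ.∸ K) ℕ.* (d ℕ.+ (K ℕ.+ H) ℕ.∸ H) ∎
    where
    identity : ∀ d K H → (d ℕ.+ (K ℕ.+ H)) ℕ.* d ℕ.+ H ℕ.* K ≡ (d ℕ.+ H) ℕ.* (d ℕ.+ K)
    identity = ℕ-Solver.solve-∀
    shuffle₁ : ∀ d K H → d ℕ.+ (K ℕ.+ H) ≡ d ℕ.+ H ℕ.+ K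
    shuffle₁ = ℕ-Solver.solve-∀
    shuffle₂ : ∀ d K H → d ℕ.+ (K ℕ.+ H) ≡ d ℕ.+ K ℕ.+ H
    shuffle₂ = ℕ-Solver.solve-∀

^-distribʳ-* : ∀ a b n → (a ℕ.* b) ℕ.^ n ≡ a ℕ.^ n ℕ.* b ℕ.^ n
^-distribʳ-* a b zero    = refl
^-distribʳ-* a b (suc n) = trans (cong (a ℕ.* b ℕ.*_) (^-distribʳ-* a b n)) (identity a b (a ℕ.^ n) (b ℕ.^ n))
  where
  identity : ∀ a b c d → a ℕ.* b ℕ.* (c ℕ.* d) ≡ a ℕ.* c ℕ.* (b ℕ.* d)
  identity = ℕ-Solver.solve-∀

-- As `(m + K) * (m ∸ K) ≤ m * m`, putting `n` in place of `m ^ R` costs at most a factor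
-- `((m ∸ K) / m) ^ (R * k)`. With the power `a` already present the total exponent is `h`, and
-- `bernoulli` makes the loss linear in `K / m`.
rescale : ∀ {m K n R k E M a c} .{{_ : ℕ.NonZero m}} → n ℕ.≤ (m ℕ.+ K) ℕ.^ R →
  (m ℕ.^ R) ℕ.^ k ℕ.* E ℕ.* (m ℕ.∸ K) ℕ.^ a ℕ.≤ M ℕ.* m ℕ.^ a ℕ.* c →
  n ℕ.^ k ℕ.* E ℕ.* (m ℕ.∸ (R ℕ.* k ℕ.+ a) ℕ.* K) ℕ.≤ M ℕ.* m ℕ.* c
rescale {m} {K} {n} {R} {k} {E} {M} {a} {c} n≤ bound =
  ℕₚ.*-cancelˡ-≤ (m ℕ.^ h) {{ℕₚ.m^n≢0 m h}} (begin
  m ℕ.^ h ℕ.* (n ℕ.^ k ℕ.* E ℕ.* (m ℕ.∸ h ℕ.* K))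
    ≡⟨ swap₁ (m ℕ.^ h) (n ℕ.^ k ℕ.* E) _ ⟩
  n ℕ.^ k ℕ.* E ℕ.* (m ℕ.^ h ℕ.* (m ℕ.∸ h ℕ.* K))
    ≤⟨ ℕₚ.*-monoʳ-≤ (n ℕ.^ k ℕ.* E) (bernoulli m K h) ⟩
  n ℕ.^ k ℕ.* E ℕ.* (G ℕ.^ h ℕ.* m)
    ≡⟨ cong (λ z → n ℕ.^ k ℕ.* E ℕ.* (z ℕ.* m)) (ℕₚ.^-distribˡ-+-* G (R ℕ.* k) a) ⟩
  n ℕ.^ k ℕ.* E ℕ.* (G ℕ.^ (R ℕ.* k) ℕ.* G ℕ.^ a ℕ.* m)
    ≡⟨ swap₂ (n ℕ.^ k) E (G ℕ.^ (R ℕ.* k)) (G ℕ.^ a) m ⟩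
  n ℕ.^ k ℕ.* G ℕ.^ (R ℕ.* k) ℕ.* (E ℕ.* G ℕ.^ a ℕ.* m)
    ≤⟨ ℕₚ.*-monoˡ-≤ (E ℕ.* G ℕ.^ a ℕ.* m) dilate ⟩
  m ℕ.^ (R ℕ.* k) ℕ.* (m ℕ.^ R) ℕ.^ k ℕ.* (E ℕ.* G ℕ.^ a ℕ.* m)
    ≡⟨ swap₃ (m ℕ.^ (R ℕ.* k)) _ E (G ℕ.^ a) m ⟩
  m ℕ.^ (R ℕ.* k) ℕ.* m ℕ.* ((m ℕ.^ R) ℕ.^ k ℕ.* E ℕ.* G ℕ.^ a)
    ≤⟨ ℕₚ.*-monoʳ-≤ (m ℕ.^ (R ℕ.* k) ℕ.* m) bound ⟩
  m ℕ.^ (R ℕ.* k) ℕ.* m ℕ.* (M ℕ.* m ℕ.^ a ℕ.* c)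
    ≡⟨ swap₄ (m ℕ.^ (R ℕ.* k)) m M (m ℕ.^ a) c ⟩
  m ℕ.^ (R ℕ.* k) ℕ.* m ℕ.^ a ℕ.* (M ℕ.* m ℕ.* c)
    ≡⟨ cong (ℕ._* (M ℕ.* m ℕ.* c)) (sym (ℕₚ.^-distribˡ-+-* m (R ℕ.* k) a)) ⟩
  m ℕ.^ h ℕ.* (M ℕ.* m ℕ.* c) ∎)
  where
  open ℕₚ.≤-Reasoning
  h G : ℕ
  h = R ℕ.* k ℕ.+ a
  G = m ℕ.∸ K
  swap₁ : ∀ a b c → a ℕ.* (b ℕ.* c) ≡ b ℕ.* (a ℕ.* c)
  swap₁ = ℕ-Solver.solve-∀
  swap₂ : ∀ a b c d e → a ℕ.* b ℕ.* (c ℕ.* d ℕ.* e) ≡ a ℕ.* c ℕ.* (b ℕ.* d ℕ.* e)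
  swap₂ = ℕ-Solver.solve-∀
  swap₃ : ∀ a b c d e → a ℕ.* b ℕ.* (c ℕ.* d ℕ.* e) ≡ a ℕ.* e ℕ.* (b ℕ.* c ℕ.* d)
  swap₃ = ℕ-Solver.solve-∀
  swap₄ : ∀ a b c d e → a ℕ.* b ℕ.* (c ℕ.* d ℕ.* e) ≡ a ℕ.* d ℕ.* (c ℕ.* b ℕ.* e)
  swap₄ = ℕ-Solver.solve-∀
  dilate : n ℕ.^ k ℕ.* G ℕ.^ (R ℕ.* k) ℕ.≤ m ℕ.^ (R ℕ.* k) ℕ.* (m ℕ.^ R) ℕ.^ k
  dilate = begin
    n ℕ.^ k ℕ.* G ℕ.^ (R ℕ.* k)
      ≤⟨ ℕₚ.*-monoˡ-≤ (G ℕ.^ (R ℕ.* k)) (ℕₚ.^-monoˡ-≤ k n≤) ⟩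
    ((m ℕ.+ K) ℕ.^ R) ℕ.^ k ℕ.* G ℕ.^ (R ℕ.* k)
      ≡⟨ cong (ℕ._* G ℕ.^ (R ℕ.* k)) (ℕₚ.^-*-assoc (m ℕ.+ K) R k) ⟩
    (m ℕ.+ K) ℕ.^ (R ℕ.* k) ℕ.* G ℕ.^ (R ℕ.* k)
      ≡⟨ sym (^-distribʳ-* (m ℕ.+ K) G (R ℕ.* k)) ⟩
    ((m ℕ.+ K) ℕ.* G) ℕ.^ (R ℕ.* k)
      ≤⟨ ℕₚ.^-monoˡ-≤ (R ℕ.* k) ([m+K][m∸K]≤m² m K) ⟩
    (m ℕ.* m) ℕ.^ (R ℕ.* k)
      ≡⟨ ^-distribʳ-* m m (R ℕ.* k) ⟩
    m ℕ.^ (R ℕ.* k) ℕ.* m ℕ.^ (R ℕ.* k)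
      ≡⟨ cong (m ℕ.^ (R ℕ.* k) ℕ.*_) (sym (ℕₚ.^-*-assoc m R k)) ⟩
    m ℕ.^ (R ℕ.* k) ℕ.* (m ℕ.^ R) ℕ.^ k ∎

locate : ∀ (f : ℕ → ℕ) {n} → f 0 ℕ.≤ n → ∀ b → n ℕ.< f b → ∃ λ y → f y ℕ.≤ n × n ℕ.< f (suc y)
locate f f0≤n zero    n<f0 = contradiction f0≤n (ℕₚ.<⇒≱ n<f0)
locate f {n} f0≤n (suc b) n<f with f b ℕₚ.≤? n
... | yes fb≤n = b , fb≤n , n<f
... | no  fb≰n = locate f f0≤n b (ℕₚ.≰⇒> fb≰n)

-- The first hypothesis gives `E - M * a / A ≤ E * h / m`, and the second makes `d` times this error
-- less than 1.
gap : ∀ {E M a A m d h} .{{_ : ℕ.NonZero A}} → A ℕ.* E ℕ.* (m ℕ.∸ h) ℕ.≤ M ℕ.* m ℕ.* a → d ℕ.* E ℕ.* h ℕ.< m →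
  d ℕ.* E ℕ.* A ℕ.< d ℕ.* M ℕ.* a ℕ.+ A
gap {E} {M} {a} {A} {m} {d} {h} lower large = ℕₚ.*-cancelˡ-< m _ _ (begin-strict
  m ℕ.* (d ℕ.* E ℕ.* A)
    ≤⟨ ℕₚ.*-monoˡ-≤ (d ℕ.* E ℕ.* A) (ℕₚ.≤-trans (ℕₚ.m≤n+m∸n m h) (ℕₚ.≤-reflexive (ℕₚ.+-comm h (m ℕ.∸ h)))) ⟩
  (m ℕ.∸ h ℕ.+ h) ℕ.* (d ℕ.* E ℕ.* A)
    ≡⟨ expand (m ℕ.∸ h) h d E A ⟩
  d ℕ.* (A ℕ.* E ℕ.* (m ℕ.∸ h)) ℕ.+ A ℕ.* (d ℕ.* E ℕ.* h)
    ≤⟨ ℕₚ.+-monoˡ-≤ _ (ℕₚ.*-monoʳ-≤ d lower) ⟩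
  d ℕ.* (M ℕ.* m ℕ.* a) ℕ.+ A ℕ.* (d ℕ.* E ℕ.* h)
    <⟨ ℕₚ.+-monoʳ-< (d ℕ.* (M ℕ.* m ℕ.* a)) (ℕₚ.*-monoʳ-< A large) ⟩
  d ℕ.* (M ℕ.* m ℕ.* a) ℕ.+ A ℕ.* m
    ≡⟨ collect d M m a A ⟩
  m ℕ.* (d ℕ.* M ℕ.* a ℕ.+ A) ∎)
  where
  open ℕₚ.≤-Reasoning
  expand : ∀ x h d E A → (x ℕ.+ h) ℕ.* (d ℕ.* E ℕ.* A) ≡ d ℕ.* (A ℕ.* E ℕ.* x) ℕ.+ A ℕ.* (d ℕ.* E ℕ.* h)
  expand = ℕ-Solver.solve-∀
  collect : ∀ d M m a A → d ℕ.* (M ℕ.* m ℕ.* a) ℕ.+ A ℕ.* m ≡ m ℕ.* (d ℕ.* M ℕ.* a ℕ.+ A)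
  collect = ℕ-Solver.solve-∀

-- In fractions: `E / M - a / A < 1 / (d * M)` and `b / B ≤ E / M` give `b / B - a / A < 1 / d`, as
-- `M ≥ 1`.
squeeze : ∀ {E M a A b B d} .{{_ : ℕ.NonZero M}} .{{_ : ℕ.NonZero B}} →
  d ℕ.* E ℕ.* A ℕ.< d ℕ.* M ℕ.* a ℕ.+ A → M ℕ.* b ℕ.≤ E ℕ.* B → b ℕ.* A ℕ.* d ℕ.< a ℕ.* B ℕ.* d ℕ.+ A ℕ.* B
squeeze {E} {M} {a} {A} {b} {B} {d} near upper = ℕₚ.*-cancelˡ-< M _ _ (begin-strict
  M ℕ.* (b ℕ.* A ℕ.* d)                     ≡⟨ swap₁ M b A d ⟩
  M ℕ.* b ℕ.* (A ℕ.* d)                     ≤⟨ ℕₚ.*-monoˡ-≤ (A ℕ.* d) upper ⟩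
  E ℕ.* B ℕ.* (A ℕ.* d)                     ≡⟨ swap₂ E B A d ⟩
  B ℕ.* (d ℕ.* E ℕ.* A)                     <⟨ ℕₚ.*-monoʳ-< B near ⟩
  B ℕ.* (d ℕ.* M ℕ.* a ℕ.+ A)               ≤⟨ ℕₚ.*-monoʳ-≤ B (ℕₚ.+-monoʳ-≤ (d ℕ.* M ℕ.* a) (ℕₚ.m≤n*m A M)) ⟩
  B ℕ.* (d ℕ.* M ℕ.* a ℕ.+ M ℕ.* A)         ≡⟨ swap₃ B d M a A ⟩
  M ℕ.* (a ℕ.* B ℕ.* d ℕ.+ A ℕ.* B)         ∎)
  where
  open ℕₚ.≤-Reasoning
  swap₁ : ∀ M b A d → M ℕ.* (b ℕ.* A ℕ.* d) ≡ M ℕ.* b ℕ.* (A ℕ.* d)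
  swap₁ = ℕ-Solver.solve-∀
  swap₂ : ∀ E B A d → E ℕ.* B ℕ.* (A ℕ.* d) ≡ B ℕ.* (d ℕ.* E ℕ.* A)
  swap₂ = ℕ-Solver.solve-∀
  swap₃ : ∀ B d M a A → B ℕ.* (d ℕ.* M ℕ.* a ℕ.+ M ℕ.* A) ≡ M ℕ.* (a ℕ.* B ℕ.* d ℕ.+ A ℕ.* B)
  swap₃ = ℕ-Solver.solve-∀

-- A positive `ε` has numerator at least 1, so it suffices to stay below the reciprocal of its
-- denominator; the hypothesis says this after cross-multiplication.
fraction-difference-< : ∀ {a A b B} .{{_ : ℕ.NonZero A}} .{{_ : ℕ.NonZero B}} (ε : ℚ) → 0ℚ ℚ.< ε →
  b ℕ.* A ℕ.* ℚ.denominatorℕ ε ℕ.< a ℕ.* B ℕ.* ℚ.denominatorℕ ε ℕ.+ A ℕ.* B →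
  (+ b) ℚ./ B ℚ.- (+ a) ℚ./ A ℚ.< ε
fraction-difference-< {a} {suc A} {b} {suc B} (mkℚ (+ zero) d _) (ℚ.*<* (ℤ.+<+ ())) lt
fraction-difference-< {a} {suc A} {b} {suc B} (mkℚ (ℤ.-[1+ _ ]) d _) (ℚ.*<* ()) lt
fraction-difference-< {a} {suc A} {b} {suc B} ε@(mkℚ (+ suc x) d _) _ lt =
  ℚₚ.toℚᵘ-cancel-< (ℚᵘₚ.<-respˡ-≃ (ℚᵘₚ.≃-sym difference) (ℚᵘ.*<* below))
  where
  β : ℚᵘ
  β = mkℚᵘ (+ b) B
  α : ℚᵘ
  α = mkℚᵘ (+ a) A
  difference : ℚ.toℚᵘ ((+ b) ℚ./ suc B ℚ.- (+ a) ℚ./ suc A) ℚᵘ.≃ β ℚᵘ.- α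
  difference = ℚᵘₚ.≃-trans (ℚₚ.toℚᵘ-homo-+ ((+ b) ℚ./ suc B) (ℚ.- ((+ a) ℚ./ suc A)))
    (ℚᵘₚ.+-cong (ℚₚ.toℚᵘ-fromℚᵘ β)
      (ℚᵘₚ.≃-trans (ℚₚ.toℚᵘ-homo‿- ((+ a) ℚ./ suc A)) (ℚᵘₚ.-‿cong (ℚₚ.toℚᵘ-fromℚᵘ α))))
  bound : + (b ℕ.* suc A ℕ.* suc d) ℤ.< + (a ℕ.* suc B ℕ.* suc d) + + (suc x ℕ.* (suc B ℕ.* suc A))
  bound = ℤ.+<+ (ℕₚ.<-≤-trans lt (ℕₚ.+-monoʳ-≤ (a ℕ.* suc B ℕ.* suc d)
    (ℕₚ.≤-trans (ℕₚ.≤-reflexive (ℕₚ.*-comm (suc A) (suc B))) (ℕₚ.m≤n*m (suc B ℕ.* suc A) (suc x)))))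
  below : (+ b * + suc A + (- (+ a)) * + suc B) * + suc d ℤ.< + suc x * + (suc B ℕ.* suc A)
  below = subst₂ ℤ._<_ left right (ℤₚ.+-monoʳ-< (- (+ (a ℕ.* suc B ℕ.* suc d))) bound)
    where
    casts : ∀ a b c → + (a ℕ.* b ℕ.* c) ≡ + a * + b * + c
    casts a b c = trans (ℤₚ.pos-* (a ℕ.* b) c) (cong (_* + c) (ℤₚ.pos-* a b))
    identity : ∀ a A b B d → - (a * B * d) + b * A * d ≡ (b * A + - a * B) * d
    identity = solve-∀
    left : - (+ (a ℕ.* suc B ℕ.* suc d)) + + (b ℕ.* suc A ℕ.* suc d) ≡ (+ b * + suc A + (- (+ a)) * + suc B) * + suc d
    left = trans (cong₂ (λ p q → - p + q) (casts a (suc B) (suc d)) (casts b (suc A) (suc d)))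
      (identity (+ a) (+ suc A) (+ b) (+ suc B) (+ suc d))
    cancel : ∀ p q → - p + (p + q) ≡ q
    cancel = solve-∀
    right : - (+ (a ℕ.* suc B ℕ.* suc d)) + (+ (a ℕ.* suc B ℕ.* suc d) + + (suc x ℕ.* (suc B ℕ.* suc A))) ≡ + suc x * + (suc B ℕ.* suc A)
    right = trans (cancel (+ (a ℕ.* suc B ℕ.* suc d)) _) (ℤₚ.pos-* (suc x) (suc B ℕ.* suc A))

∣-∣-< : ∀ {p q ε : ℚ} → p ℚ.- q ℚ.< ε → q ℚ.- p ℚ.< ε → ℚ.∣ p ℚ.- q ∣ ℚ.< ε
∣-∣-< {p} {q} {ε} p-q<ε q-p<ε with ℚₚ.∣p∣≡p∨∣p∣≡-p (p ℚ.- q)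
... | inj₁ eq = subst (ℚ._< ε) (sym eq) p-q<ε
... | inj₂ eq = subst (ℚ._< ε) (trans (sym (⁻¹-anti-homo-// ℚₚ.+-0-group p q)) (sym eq)) q-p<ε

-- The labelled design, the two bounds and convergence.

record LabelledDesign (k ℓ : ℕ) : Set where
  field
    E M r : ℕ
    D     : Fin E → Subset (2 ℕ.+ k)
    α     : Fin r → Fin (2 ℕ.+ k) → ℤ
    X     : Fin r → Fin E → ℤ
    label : Fin E → Fin (2 ℕ.+ k) → Fin (2 ℕ.+ k) → ℕ

    1≤M             : 1 ℕ.≤ M
    size-D          : ∀ e → Subset.∣ D e ∣ ≡ 2 ℕ.+ ℓ
    pair-count      : E ℕ.* ((2 ℕ.+ ℓ) ℕ.* (2 ℕ.+ ℓ) ℕ.∸ (2 ℕ.+ ℓ)) ≡ offDiagonal (2 ℕ.+ k) (λ _ _ → 1) ℕ.* M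
    α-spread        : ∀ c → Spread (α c)
    -- Both (i, j) and (j, i) carry a gadget, whence the factor 2.
    label-sum       : ∀ e i j → ∑ℤ (λ c → α c i * α c j * X c e) ≡ + (2 ℕ.* label e i j)
    label-<         : ∀ {e i j} → i ≢ j → i ∈ D e → j ∈ D e → label e i j ℕ.< M
    label-injective : ∀ {e f i j} → i ∈ D e → j ∈ D e → i ∈ D f → j ∈ D f → label e i j ≡ label f i j → e ≡ f

labelledDesign : ∀ {k ℓ} → ℓ ℕ.≤ k → LabelledDesign k ℓ
labelledDesign {k} {ℓ} ℓ≤k = record
  { E               = length blocks
  ; M               = length (subsets k ℓ)
  ; r               = length (components κ)
  ; D               = D
  ; α               = λ c → proj₁ (List.lookup (components κ) c)
  ; X               = λ c → proj₂ (List.lookup (components κ) c)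
  ; label           = λ e i j → κ i j e
  ; 1≤M             = subsets-nonempty ℓ≤k
  ; size-D          = λ e → All.lookup (subsets-size (2 ℕ.+ k) (2 ℕ.+ ℓ)) (∈-lookup e)
  ; pair-count      = subsets-pairs k ℓ
  ; α-spread        = λ c → All.lookup (components-spread κ) (∈-lookup c)
  ; label-sum       = λ e i j → trans (components-contribution κ e i j) (cong +_ (cong (κ i j e ℕ.+_)
                        (trans (κ-sym j i e) (sym (ℕₚ.+-identityʳ (κ i j e))))))
  ; label-<         = λ {e} {i} {j} i≢j i∈ j∈ →
                        subst (κ i j e ℕ.<_) (degree₂ k ℓ i≢j) (rank-< _ blocks e (χχ≡1 {e} i∈ j∈))
  ; label-injective = λ {e} {f} i∈e j∈e i∈f j∈f → rank-injective _ blocks (χχ≡1 {e} i∈e j∈e) (χχ≡1 {f} i∈f j∈f)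
  }
  where
  blocks : List (Subset (2 ℕ.+ k))
  blocks = subsets (2 ℕ.+ k) (2 ℕ.+ ℓ)
  D : Fin (length blocks) → Subset (2 ℕ.+ k)
  D = List.lookup blocks
  κ : Fin (2 ℕ.+ k) → Fin (2 ℕ.+ k) → Fin (length blocks) → ℕ
  κ i j = rank (λ D → χ D i ℕ.* χ D j) blocks
  κ-sym : ∀ i j e → κ i j e ≡ κ j i e
  κ-sym i j = rank-cong (λ D → ℕₚ.*-comm (χ D i) (χ D j)) blocks
  χχ≡1 : ∀ {e i j} → i ∈ D e → j ∈ D e → χ (D e) i ℕ.* χ (D e) j ≡ 1
  χχ≡1 i∈ j∈ = cong₂ ℕ._*_ (χ-∈ i∈) (χ-∈ j∈)

module Asymptotics {k ℓ : ℕ} (design : LabelledDesign k ℓ) where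
  open LabelledDesign design

  R : ℕ
  R = suc r

  -- The factorial makes the differences of α and β units modulo 1 + Ky; the other factor absorbs the rounding of W
  -- and the discarded rooks.
  abstract
    K : ℕ
    K = (3 ℕ.* (2 ℕ.+ k)) ! ℕ.* (2 ℕ.* M ℕ.+ (2 ℕ.+ k))

    !∣K : (3 ℕ.* (2 ℕ.+ k)) ! ℕ∣.∣ K
    !∣K = ℕ∣.m∣m*n (2 ℕ.* M ℕ.+ (2 ℕ.+ k))

    2M+k≤K : 2 ℕ.* M ℕ.+ (2 ℕ.+ k) ℕ.≤ K
    2M+k≤K = ℕₚ.m≤n*m _ ((3 ℕ.* (2 ℕ.+ k)) !) {{(3 ℕ.* (2 ℕ.+ k)) ℕₚ.!≢0}}

  instance
    2M≢0 : ℕ.NonZero (2 ℕ.* M)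
    2M≢0 = ℕ.>-nonZero (ℕₚ.≤-trans (s≤s z≤n) (ℕₚ.*-monoʳ-≤ 2 1≤M))

  -- By `pair-count` the ratio `o / p` of the pair counts in `rooks-upper-bound` is `E / M`.
  upper-bound : ∀ {n} (rs : List (Rook n (2 ℕ.+ k) (2 ℕ.+ ℓ))) → ValidPlacement rs → M ℕ.* length rs ℕ.≤ E ℕ.* n ℕ.^ k
  upper-bound {n} rs valid = ℕₚ.*-cancelʳ-≤ _ _ p (begin
    M ℕ.* length rs ℕ.* p        ≡⟨ ℕₚ.*-assoc M _ p ⟩
    M ℕ.* (length rs ℕ.* p)      ≤⟨ ℕₚ.*-monoʳ-≤ M (rooks-upper-bound rs valid) ⟩
    M ℕ.* (o ℕ.* n ℕ.^ k)        ≡⟨ swap₁ M o _ ⟩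
    o ℕ.* M ℕ.* n ℕ.^ k          ≡⟨ cong (ℕ._* n ℕ.^ k) (sym pair-count) ⟩
    E ℕ.* p ℕ.* n ℕ.^ k          ≡⟨ swap₂ E p _ ⟩
    E ℕ.* n ℕ.^ k ℕ.* p          ∎)
    where
    open ℕₚ.≤-Reasoning
    o p : ℕ
    o = offDiagonal (2 ℕ.+ k) (λ _ _ → 1)
    p = (2 ℕ.+ ℓ) ℕ.* (2 ℕ.+ ℓ) ℕ.∸ (2 ℕ.+ ℓ)
    instance
      p≢0 : ℕ.NonZero p
      p≢0 = subst ℕ.NonZero (sym (ℕₚ.m+n∸m≡n (2 ℕ.+ ℓ) ((1 ℕ.+ ℓ) ℕ.* (2 ℕ.+ ℓ)))) _
    swap₁ : ∀ a b c → a ℕ.* (b ℕ.* c) ≡ b ℕ.* a ℕ.* c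
    swap₁ = ℕ-Solver.solve-∀
    swap₂ : ∀ a b c → a ℕ.* b ℕ.* c ≡ a ℕ.* c ℕ.* b
    swap₂ = ℕ-Solver.solve-∀

  module _ (y : ℕ) where

    -- The sums in `label-sum` carry a factor 2, so `W` is taken even and the shifts are scaled by
    -- its half. Rounding costs `M * W` at most `2 * M`.
    m w W : ℕ
    m = suc (K ℕ.* y)
    w = m ℕDM./ (2 ℕ.* M)
    W = 2 ℕ.* w

    W*M≤m : W ℕ.* M ℕ.≤ m
    W*M≤m = subst (ℕ._≤ m) (swap w M) (ℕDM.m/n*n≤m m (2 ℕ.* M))
      where
      swap : ∀ w M → w ℕ.* (2 ℕ.* M) ≡ 2 ℕ.* w ℕ.* M
      swap = ℕ-Solver.solve-∀

    m∸2M≤M*W : m ℕ.∸ 2 ℕ.* M ℕ.≤ M ℕ.* W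
    m∸2M≤M*W = begin
      m ℕ.∸ 2 ℕ.* M
        ≡⟨ cong (ℕ._∸ 2 ℕ.* M) (ℕDM.m≡m%n+[m/n]*n m (2 ℕ.* M)) ⟩
      (m ℕDM.% (2 ℕ.* M) ℕ.+ w ℕ.* (2 ℕ.* M)) ℕ.∸ 2 ℕ.* M
        ≤⟨ ℕₚ.∸-monoˡ-≤ (2 ℕ.* M) (ℕₚ.+-monoˡ-≤ (w ℕ.* (2 ℕ.* M)) (ℕₚ.<⇒≤ (ℕDM.m%n<n m (2 ℕ.* M)))) ⟩
      (2 ℕ.* M ℕ.+ w ℕ.* (2 ℕ.* M)) ℕ.∸ 2 ℕ.* M
        ≡⟨ ℕₚ.m+n∸m≡n (2 ℕ.* M) _ ⟩
      w ℕ.* (2 ℕ.* M)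
        ≡⟨ swap w M ⟩
      M ℕ.* W ∎
      where
      open ℕₚ.≤-Reasoning
      swap : ∀ w M → w ℕ.* (2 ℕ.* M) ≡ M ℕ.* (2 ℕ.* w)
      swap = ℕ-Solver.solve-∀

    shift : Fin r → Fin E → ℤ
    shift c e = + w * X c e

    label-shift : ∀ e {i j} → i ≢ j → ∑ℤ (λ c → α c i * α c j * shift c e) ≡ + (W ℕ.* label e i j)
    label-shift e {i} {j} _ = begin
      ∑ℤ (λ c → α c i * α c j * shift c e)
        ≡⟨ ∑ℤ-cong (λ c → swap (α c i * α c j) (+ w) (X c e)) ⟩
      ∑ℤ (λ c → + w * (α c i * α c j * X c e))
        ≡⟨ ∑ℤ-*ˡ (+ w) (λ c → α c i * α c j * X c e) ⟩
      + w * ∑ℤ (λ c → α c i * α c j * X c e)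
        ≡⟨ cong (λ z → + w * z) (label-sum e i j) ⟩
      + w * + (2 ℕ.* label e i j)
        ≡⟨ sym (ℤₚ.pos-* w _) ⟩
      + (w ℕ.* (2 ℕ.* label e i j))
        ≡⟨ cong +_ (regroup w (label e i j)) ⟩
      + (W ℕ.* label e i j) ∎
      where
      open ≡-Reasoning
      swap : ∀ a b c → a * (b * c) ≡ b * (a * c)
      swap = solve-∀
      regroup : ∀ w x → w ℕ.* (2 ℕ.* x) ≡ 2 ℕ.* w ℕ.* x
      regroup = ℕ-Solver.solve-∀

    β : Fin (2 ℕ.+ k) → ℤ
    β d = + (3 ℕ.* toℕ d)

    α-cancels : ∀ c {i j} → i ≢ j → Cancels m (α c i - α c j)
    α-cancels c = spread-cancels {2 ℕ.+ k} {K} {y} !∣K (α-spread c)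

    β-cancels : ∀ {i j} → i ≢ j → Cancels m (β i - β j)
    β-cancels = spread-cancels {2 ℕ.+ k} {K} {y} {β} !∣K (λ d → 0 , s≤s z≤n , refl)

    W≤m : W ℕ.≤ m
    W≤m = ℕₚ.≤-trans (ℕₚ.m≤m*n W M {{ℕ.>-nonZero 1≤M}}) W*M≤m

    open Packing.Separation m D α shift β W label M W*M≤m label-shift label-< label-injective α-cancels β-cancels

    lower-bound : ∀ {n} c → m ℕ.^ R ℕ.≤ n → n ℕ.≤ (m ℕ.+ K) ℕ.^ R →
      (∀ (rs : List (Rook n (2 ℕ.+ k) (2 ℕ.+ ℓ))) → ValidPlacement rs → length rs ℕ.≤ c) →
      -- The averaged bound has `q ^ (2 + k)` on the left and two factors `q = m * m ^ r` on the
      -- right, so cancelling `q * q` leaves exponent `k`. Of the `suc E` factors `m ∸ K`, one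
      -- covers the rounding of `W` and `E` cover the discarded rooks.
      n ℕ.^ k ℕ.* E ℕ.* (m ℕ.∸ (R ℕ.* k ℕ.+ suc E) ℕ.* K) ℕ.≤ M ℕ.* m ℕ.* c
    lower-bound {n} c m^R≤n n≤ maximal = rescale {m} {K} {n} {R} {k} {E} {M} {suc E} {c} n≤
      (ℕₚ.*-cancelˡ-≤ (q ℕ.* q) {{ℕₚ.m*n≢0 q q {{q≢0}} {{q≢0}}}} (begin
        q ℕ.* q ℕ.* (q ℕ.^ k ℕ.* E ℕ.* (G ℕ.* G ℕ.^ E))
          ≤⟨ ℕₚ.*-monoʳ-≤ (q ℕ.* q) (ℕₚ.*-monoʳ-≤ (q ℕ.^ k ℕ.* E)
               (ℕₚ.*-mono-≤ (ℕₚ.≤-trans (ℕₚ.∸-monoʳ-≤ m (ℕₚ.≤-trans (ℕₚ.m≤m+n (2 ℕ.* M) (2 ℕ.+ k)) 2M+k≤K)) m∸2M≤M*W)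
                            (ℕₚ.^-monoˡ-≤ E (ℕₚ.∸-monoʳ-≤ m (ℕₚ.≤-trans (ℕₚ.m≤n+m (2 ℕ.+ k) (2 ℕ.* M)) 2M+k≤K))))) ⟩
        q ℕ.* q ℕ.* (q ℕ.^ k ℕ.* E ℕ.* (M ℕ.* W ℕ.* (m ℕ.∸ (2 ℕ.+ k)) ℕ.^ E))
          ≡⟨ swap₁ q (q ℕ.^ k) E M W _ ⟩
        M ℕ.* (q ℕ.^ (2 ℕ.+ k) ℕ.* E ℕ.* (W ℕ.* (m ℕ.∸ (2 ℕ.+ k)) ℕ.^ E))
          ≤⟨ ℕₚ.*-monoʳ-≤ M (averaged-bound c maximal) ⟩
        M ℕ.* (m ℕ.* (m ℕ.^ r ℕ.* (m ℕ.^ r ℕ.* (m ℕ.* (m ℕ.* m ℕ.^ E))) ℕ.* c))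
          ≡⟨ swap₂ M m (m ℕ.^ r) (m ℕ.^ E) c ⟩
        q ℕ.* q ℕ.* (M ℕ.* (m ℕ.* m ℕ.^ E) ℕ.* c) ∎))
      where
      open ℕₚ.≤-Reasoning
      open Placement m D α shift β W W≤m good-separated {n} {2 ℕ.+ ℓ} m^R≤n (s≤s (s≤s z≤n)) size-D
      q G : ℕ
      q = m ℕ.^ R
      G = m ℕ.∸ K
      q≢0 : ℕ.NonZero q
      q≢0 = ℕₚ.m^n≢0 m R
      swap₁ : ∀ q Q E M W x → q ℕ.* q ℕ.* (Q ℕ.* E ℕ.* (M ℕ.* W ℕ.* x)) ≡ M ℕ.* (q ℕ.* (q ℕ.* Q) ℕ.* E ℕ.* (W ℕ.* x))
      swap₁ = ℕ-Solver.solve-∀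
      swap₂ : ∀ M m f e c → M ℕ.* (m ℕ.* (f ℕ.* (f ℕ.* (m ℕ.* (m ℕ.* e))) ℕ.* c)) ≡ m ℕ.* f ℕ.* (m ℕ.* f) ℕ.* (M ℕ.* (m ℕ.* e) ℕ.* c)
      swap₂ = ℕ-Solver.solve-∀

  -- Consecutive admissible moduli `1 + K * y` differ by `K`, so `suc n` lies between `m ^ R` and
  -- `(m + K) ^ R` for one of them. Beyond `N` this `m` is large enough for `gap`.
  near-limit : ∀ (c : ℕ → ℕ) → (∀ n → IsMaxRooks n (2 ℕ.+ k) (2 ℕ.+ ℓ) (c n)) → ∀ d → ∃ λ N → ∀ n → N ℕ.≤ n → d ℕ.* E ℕ.* suc n ℕ.^ k ℕ.< d ℕ.* M ℕ.* c (suc n) ℕ.+ suc n ℕ.^ k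
  near-limit c maximum d = f y₀ , bound
    where
    h y₀ : ℕ
    h = (R ℕ.* k ℕ.+ suc E) ℕ.* K
    -- From `y₀ ≤ y` follows `d * E * h ≤ y ≤ K * y < m`, the size condition of `gap`.
    y₀ = d ℕ.* E ℕ.* h
    f : ℕ → ℕ
    f y = suc (K ℕ.* y) ℕ.^ R
    1≤K : 1 ℕ.≤ K
    1≤K = ℕₚ.≤-trans (ℕₚ.≤-trans (s≤s z≤n) (ℕₚ.m≤n+m (2 ℕ.+ k) (2 ℕ.* M))) 2M+k≤K
    y≤Ky : ∀ y → y ℕ.≤ K ℕ.* y
    y≤Ky y = ℕₚ.m≤n*m y K {{ℕ.>-nonZero 1≤K}}
    f-mono : ∀ {y z} → y ℕ.≤ z → f y ℕ.≤ f z
    f-mono y≤z = ℕₚ.^-monoˡ-≤ R (s≤s (ℕₚ.*-monoʳ-≤ K y≤z))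
    y<f : ∀ y → y ℕ.< f y
    y<f y = ℕₚ.≤-trans (s≤s (y≤Ky y)) (ℕₚ.m≤m*n (suc (K ℕ.* y)) (suc (K ℕ.* y) ℕ.^ r) {{ℕₚ.m^n≢0 (suc (K ℕ.* y)) (r)}})
    f0≡1 : f 0 ≡ 1
    f0≡1 = trans (cong (λ z → suc z ℕ.^ R) (ℕₚ.*-zeroʳ K)) (ℕₚ.^-zeroˡ R)
    bound : ∀ n → f y₀ ℕ.≤ n → d ℕ.* E ℕ.* suc n ℕ.^ k ℕ.< d ℕ.* M ℕ.* c (suc n) ℕ.+ suc n ℕ.^ k
    bound n fy₀≤n with locate f {suc n} (subst (ℕ._≤ suc n) (sym f0≡1) (s≤s z≤n)) (suc n) (y<f (suc n))
    ... | y , fy≤ , <fy⁺ = gap {E} {M} {c (suc n)} {suc n ℕ.^ k} {suc (K ℕ.* y)} {d} {h} {{ℕₚ.m^n≢0 (suc n) k}}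
            (lower-bound y (c (suc n)) fy≤ (ℕₚ.<⇒≤ (subst (λ z → suc n ℕ.< suc z ℕ.^ R) (trans (ℕₚ.*-suc K y) (ℕₚ.+-comm K (K ℕ.* y))) <fy⁺)) (proj₂ (maximum (suc n))))
            (s≤s (ℕₚ.≤-trans y₀≤y (y≤Ky y)))
      where
      y₀≤y : y₀ ℕ.≤ y
      y₀≤y with y₀ ℕₚ.≤? y
      ... | yes p = p
      ... | no ¬p = contradiction (ℕₚ.≤-trans (f-mono (ℕₚ.≰⇒> ¬p)) (ℕₚ.m≤n⇒m≤1+n fy₀≤n)) (ℕₚ.<⇒≱ <fy⁺)

  -- Both ratios are compared with `E / M`. The upper bound holds at every index and the lower one
  -- from `N` on, so each one-sided estimate `close` asks only that the subtracted term have large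
  -- index.
  converges : ∀ (c : ℕ → ℕ) → (∀ n → IsMaxRooks n (2 ℕ.+ k) (2 ℕ.+ ℓ) (c n)) → ConvergesInℝ (ratio c (2 ℕ.+ k))
  converges c maximum ε 0<ε = N , λ m p N≤m N≤p →
    ∣-∣-< {ratio c (2 ℕ.+ k) m} {ratio c (2 ℕ.+ k) p} (close m p N≤p) (close p m N≤m)
    where
    limit : ∃ λ N → ∀ n → N ℕ.≤ n → ℚ.denominatorℕ ε ℕ.* E ℕ.* suc n ℕ.^ k ℕ.< ℚ.denominatorℕ ε ℕ.* M ℕ.* c (suc n) ℕ.+ suc n ℕ.^ k
    limit = near-limit c maximum (ℚ.denominatorℕ ε)
    N : ℕ
    N = proj₁ limit
    upper : ∀ n → M ℕ.* c n ℕ.≤ E ℕ.* n ℕ.^ k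
    upper n with maximum n
    ... | (rs , valid , length≡c) , _ = subst (λ a → M ℕ.* a ℕ.≤ E ℕ.* n ℕ.^ k) length≡c (upper-bound rs valid)
    close : ∀ m p → N ℕ.≤ p → ratio c (2 ℕ.+ k) m ℚ.- ratio c (2 ℕ.+ k) p ℚ.< ε
    close m p N≤p = fraction-difference-< {c (suc p)} {suc p ℕ.^ k} {c (suc m)} {suc m ℕ.^ k} {{ℕₚ.m^n≢0 (suc p) k}} {{ℕₚ.m^n≢0 (suc m) k}} ε 0<ε
      (squeeze {E} {M} {c (suc p)} {suc p ℕ.^ k} {c (suc m)} {suc m ℕ.^ k} {ℚ.denominatorℕ ε} {{ℕ.>-nonZero 1≤M}} {{ℕₚ.m^n≢0 (suc m) k}}
        (proj₂ limit p N≤p) (upper (suc m)))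

theorem6 : (k ℓ : ℕ) → 2 ≤ ℓ → ℓ ≤ k → (c : ℕ → ℕ) →
    (∀ n → IsMaxRooks n k ℓ (c n)) → ConvergesInℝ (ratio c k)
theorem6 (suc (suc k)) (suc (suc ℓ)) (s≤s (s≤s _)) (s≤s (s≤s ℓ≤k)) = Asymptotics.converges (labelledDesign ℓ≤k)
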